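{- Let $u$ be a field ordinal. Then the algebraic closure of $u$ in $\mathrm{On}_2$ (the collection of all ordinals that are algebraic over $u$ with respect to the Nim operations) is an ordinal, and it is an algebraic closure of the field $u$.
   Context: $\oplus$ and $\otimes$ denote Nim-sum and Nim-product of ordinals, defined recursively by $\alpha \oplus \beta = \operatorname{mex}\{\alpha' \oplus \beta, \alpha \oplus \beta' \mid \alpha'<\alpha, \beta'<\beta\}$ and $\alpha \otimes \beta = \operatorname{mex}\{(\alpha' \otimes \beta) \oplus (\alpha \otimes \beta') \oplus (\alpha' \otimes \beta') \mid \alpha'<\alpha, \beta'<\beta\}$, where $\operatorname{mex}(S)$ is the least ordinal not in $S$. With these operations the class of ordinals is a Field (a field whose domain is a proper class) of characteristic 2, denoted $\mathrm{On}_2$. An ordinal $u$ is identified with the set of smaller ordinals; a field ordinal is an ordinal $u$ that is a subfield of $\mathrm{On}_2$. All polynomials are with respect to the Nim operations. -}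

module Defs where

open import Algebra.Bundles.Raw using (RawRing)
open import Algebra.Morphism.Structures using (module RingMorphisms)
open import Algebra.Structures using (IsCommutativeRing)
open import Axiom.ExcludedMiddle using (ExcludedMiddle)
open import Data.Empty.Polymorphic using (⊥)
open import Data.List.Base using (List; []; _∷_; map)
open import Data.List.Relation.Unary.Any using (Any)
open import Data.Maybe.Base using (Maybe; just; nothing)
open import Data.Product using (Σ; ∃; ∃-syntax; _×_; _,_; proj₁; proj₂)
open import Data.Sum using (_⊎_; inj₁; inj₂; [_,_]′)
open import Data.Unit.Polymorphic.Base using (⊤)
open import Function.Base using (_∘_; id)
open import Induction.WellFounded using (Acc; acc; WellFounded)
open import Level using (Level; suc; _⊔_)
open import Relation.Nullary using (¬_; yes; no; contradiction)

private
  variable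
    a b c ℓ p : Level

-- `sup I f` is the least ordinal strictly above every `f i`.  Ordinals are
-- compared with the setoid equality _≈_ below; the relations _≤_ and _<_ are
-- the usual orders once excluded middle is assumed (see ≰⇒>).  `Set ℓ` plays
-- the role of the universe of sets, so Ord ℓ, which lives in Set (suc ℓ), is
-- the proper class of all ordinals.

data Ord (ℓ : Level) : Set (suc ℓ) where
  sup : (I : Set ℓ) → (I → Ord ℓ) → Ord ℓ

infix 4 _≤_ _<_ _≈_

mutual
  _≤_ : Ord ℓ → Ord ℓ → Set ℓ
  sup I f ≤ β = ∀ i → f i < β

  _<_ : Ord ℓ → Ord ℓ → Set ℓ
  α < sup J g = ∃[ j ] α ≤ g j

_≈_ : Ord ℓ → Ord ℓ → Set ℓ
α ≈ β = α ≤ β × β ≤ α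

≤-refl : (α : Ord ℓ) → α ≤ α
≤-refl (sup I f) i = i , ≤-refl (f i)

mutual
  ≤-trans : (α β γ : Ord ℓ) → α ≤ β → β ≤ γ → α ≤ γ
  ≤-trans (sup I f) β γ p q i = <-≤-trans (f i) β γ (p i) q

  <-≤-trans : (α β γ : Ord ℓ) → α < β → β ≤ γ → α < γ
  <-≤-trans α (sup J g) γ (j , p) q = ≤-<-trans α (g j) γ p (q j)

  ≤-<-trans : (α β γ : Ord ℓ) → α ≤ β → β < γ → α < γ
  ≤-<-trans α β (sup K h) p (k , q) = k , ≤-trans α β (h k) p q

<⇒≤ : (α β : Ord ℓ) → α < β → α ≤ β
<⇒≤ (sup I f) (sup J g) (j , p) i = j , <⇒≤ (f i) (g j) (p i)

<-irrefl : (α : Ord ℓ) → ¬ (α < α)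
<-irrefl (sup I f) (i , p) = <-irrefl (f i) (<-≤-trans (f i) (sup I f) (f i) (i , ≤-refl (f i)) p)

≈-refl : (α : Ord ℓ) → α ≈ α
≈-refl α = ≤-refl α , ≤-refl α

≈-sym : {α β : Ord ℓ} → α ≈ β → β ≈ α
≈-sym (p , q) = q , p

≈-trans : {α β γ : Ord ℓ} → α ≈ β → β ≈ γ → α ≈ γ
≈-trans {α = α} {β} {γ} (p , q) (r , s) = ≤-trans α β γ p r , ≤-trans γ β α s q

<-wellFounded : WellFounded (_<_ {ℓ})
<-wellFounded α = go α α (≤-refl α)
  where
  go : (β α : Ord ℓ) → α ≤ β → Acc _<_ α
  go (sup J g) α p = acc λ {γ} γ<α →
    let j , q = <-≤-trans γ α (sup J g) γ<α p in go (g j) γ q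

-- A small index for the ordinals below α; with excluded middle every ordinal
-- below α occurs, up to _≈_ (see el-surjective).

Below : Ord ℓ → Set ℓ
Below (sup I f) = Σ I λ i → Maybe (Below (f i))

el : (α : Ord ℓ) → Below α → Ord ℓ
el (sup I f) (i , nothing) = f i
el (sup I f) (i , just b)  = el (f i) b

el< : (α : Ord ℓ) (b : Below α) → el α b < α
el< (sup I f) (i , nothing) = i , ≤-refl (f i)
el< (sup I f) (i , just b)  = i , <⇒≤ (el (f i) b) (f i) (el< (f i) b)

IsMex : (Ord ℓ → Set p) → Ord ℓ → Set (suc ℓ ⊔ p)
IsMex S m = ¬ S m × (∀ γ → γ < m → S γ)

-- The least ordinal outside the family f is the least strict upper bound of
-- those members of f all of whose predecessors are also members of f
-- (see mex-isMex).

mex : {I : Set ℓ} → (I → Ord ℓ) → Ord ℓ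
mex {I = I} f =
  sup (Σ I λ i → (b : Below (f i)) → ∃[ j ] el (f i) b ≈ f j) (f ∘ proj₁)

𝟘 𝟙 : Ord ℓ
𝟘 = sup ⊥ λ ()
𝟙 = sup ⊤ λ _ → 𝟘

nimSum : (α β : Ord ℓ) → Acc _<_ α → Acc _<_ β → Ord ℓ
nimSum α β (acc r) (acc s) = mex {I = Below α ⊎ Below β}
  [ (λ a → nimSum (el α a) β (r (el< α a)) (acc s))
  , (λ b → nimSum α (el β b) (acc r) (s (el< β b)))
  ]′

infixl 6 _⊕_
infixl 7 _⊗_

_⊕_ : Ord ℓ → Ord ℓ → Ord ℓ
α ⊕ β = nimSum α β (<-wellFounded α) (<-wellFounded β)

nimProduct : (α β : Ord ℓ) → Acc _<_ α → Acc _<_ β → Ord ℓ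
nimProduct α β (acc r) (acc s) = mex {I = Below α × Below β} λ (a , b) →
  nimProduct (el α a) β        (r (el< α a)) (acc s) ⊕
  nimProduct α        (el β b) (acc r)       (s (el< β b)) ⊕
  nimProduct (el α a) (el β b) (r (el< α a)) (s (el< β b))

_⊗_ : Ord ℓ → Ord ℓ → Ord ℓ
α ⊗ β = nimProduct α β (<-wellFounded α) (<-wellFounded β)

module Classical {ℓ : Level} (em : ExcludedMiddle ℓ) where

  <⊎≈ : {α β : Ord ℓ} → α ≤ β → α < β ⊎ α ≈ β
  ≰⇒> : (α β : Ord ℓ) → ¬ (α ≤ β) → β < α

  el-surjective : (α : Ord ℓ) {γ : Ord ℓ} → γ < α → ∃[ b ] γ ≈ el α b
  el-surjective (sup I f) {γ} (i , p) with <⊎≈ p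
  ... | inj₂ γ≈fi = (i , nothing) , γ≈fi
  ... | inj₁ γ<fi = let b , e = el-surjective (f i) γ<fi in (i , just b) , e

  <⊎≈ {α} {β} p with em {β ≤ α}
  ... | yes q = inj₂ (p , q)
  ... | no ¬q = inj₁ (≰⇒> β α ¬q)

  ≰⇒> (sup I f) β ¬p with em {∃[ i ] ¬ (f i < β)}
  ... | no ¬∃ = contradiction below ¬p
    where
    below : ∀ i → f i < β
    below i with em {f i < β}
    ... | yes q = q
    ... | no ¬q = contradiction (i , ¬q) ¬∃
  ... | yes (i , fi≮β) = i , β≤fi β fi≮β
    where
    β≤fi : ∀ β → ¬ (f i < β) → β ≤ f i
    β≤fi (sup J g) ¬q j = ≰⇒> (f i) (g j) λ r → ¬q (j , r)

  mex-isMex : {I : Set ℓ} (f : I → Ord ℓ) → IsMex (λ γ → ∃[ i ] γ ≈ f i) (mex f)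
  mex-isMex f = outside , inside
    where
    inside : ∀ γ → γ < mex f → ∃[ i ] γ ≈ f i
    inside γ ((i , h) , γ≤fi) with <⊎≈ γ≤fi
    ... | inj₂ γ≈fi = i , γ≈fi
    ... | inj₁ γ<fi =
      let b , e = el-surjective (f i) γ<fi
          j , e′ = h b
      in j , ≈-trans e e′

    outside : ¬ (∃[ i ] mex f ≈ f i)
    outside (i , m≤fi , fi≤m) = <-irrefl (mex f)
      ((i , λ b → inside (el (f i) b)
                    (<-≤-trans (el (f i) b) (f i) (mex f) (el< (f i) b) fi≤m))
      , m≤fi)

  el-cong : {α α′ : Ord ℓ} → α ≈ α′ → (b : Below α) → ∃[ b′ ] el α b ≈ el α′ b′
  el-cong {α} {α′} (p , _) b =
    el-surjective α′ (<-≤-trans (el α b) α α′ (el< α b) p)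

  mex-≤ : {I J : Set ℓ} {f : I → Ord ℓ} {g : J → Ord ℓ} →
          (∀ i → ∃[ j ] f i ≈ g j) → (∀ j → ∃[ i ] g j ≈ f i) → mex f ≤ mex g
  mex-≤ {f = f} {g} p q (i , h) =
    let j , e = p i
    in (j , λ b → let b′ , d  = el-cong (≈-sym e) b
                      k  , d′ = h b′
                      l  , d″ = p k
                  in l , ≈-trans d (≈-trans d′ d″))
      , proj₁ e

  mex-cong : {I J : Set ℓ} {f : I → Ord ℓ} {g : J → Ord ℓ} →
             (∀ i → ∃[ j ] f i ≈ g j) → (∀ j → ∃[ i ] g j ≈ f i) → mex f ≈ mex g
  mex-cong p q = mex-≤ p q , mex-≤ q p

  nimSum-cong : {α α′ β β′ : Ord ℓ} → α ≈ α′ → β ≈ β′ →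
                ∀ x y x′ y′ → nimSum α β x y ≈ nimSum α′ β′ x′ y′
  nimSum-cong {α} {α′} {β} {β′} p q (acc r) (acc s) (acc r′) (acc s′) =
    mex-cong
      (λ where
        (inj₁ a) → let a′ , e = el-cong p a in inj₁ a′ ,
          nimSum-cong e q (r (el< α a)) (acc s) (r′ (el< α′ a′)) (acc s′)
        (inj₂ b) → let b′ , e = el-cong q b in inj₂ b′ ,
          nimSum-cong p e (acc r) (s (el< β b)) (acc r′) (s′ (el< β′ b′)))
      (λ where
        (inj₁ a′) → let a , e = el-cong (≈-sym p) a′ in inj₁ a , ≈-sym (
          nimSum-cong (≈-sym e) q (r (el< α a)) (acc s) (r′ (el< α′ a′)) (acc s′))
        (inj₂ b′) → let b , e = el-cong (≈-sym q) b′ in inj₂ b , ≈-sym (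
          nimSum-cong p (≈-sym e) (acc r) (s (el< β b)) (acc r′) (s′ (el< β′ b′))))

  ⊕-cong : {α α′ β β′ : Ord ℓ} → α ≈ α′ → β ≈ β′ → α ⊕ β ≈ α′ ⊕ β′
  ⊕-cong p q = nimSum-cong p q _ _ _ _

  nimProduct-cong : {α α′ β β′ : Ord ℓ} → α ≈ α′ → β ≈ β′ →
                    ∀ x y x′ y′ → nimProduct α β x y ≈ nimProduct α′ β′ x′ y′
  nimProduct-cong {α} {α′} {β} {β′} p q (acc r) (acc s) (acc r′) (acc s′) =
    mex-cong
      (λ (a , b) →
        let a′ , e = el-cong p a ; b′ , d = el-cong q b
        in (a′ , b′) , option a b a′ b′ e d)
      (λ (a′ , b′) →
        let a , e = el-cong (≈-sym p) a′ ; b , d = el-cong (≈-sym q) b′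
        in (a , b) , ≈-sym (option a b a′ b′ (≈-sym e) (≈-sym d)))
    where
    option : ∀ a b a′ b′ → el α a ≈ el α′ a′ → el β b ≈ el β′ b′ → _ ≈ _
    option a b a′ b′ e d = ⊕-cong
      (⊕-cong
        (nimProduct-cong e q (r (el< α a)) (acc s) (r′ (el< α′ a′)) (acc s′))
        (nimProduct-cong p d (acc r) (s (el< β b)) (acc r′) (s′ (el< β′ b′))))
      (nimProduct-cong e d (r (el< α a)) (s (el< β b)) (r′ (el< α′ a′)) (s′ (el< β′ b′)))

  ⊗-cong : {α α′ β β′ : Ord ℓ} → α ≈ α′ → β ≈ β′ → α ⊗ β ≈ α′ ⊗ β′
  ⊗-cong p q = nimProduct-cong p q _ _ _ _

  ⊕-isMex : (α β : Ord ℓ) →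
    IsMex (λ γ → (∃[ α′ ] α′ < α × γ ≈ α′ ⊕ β) ⊎ (∃[ β′ ] β′ < β × γ ≈ α ⊕ β′))
          (α ⊕ β)
  ⊕-isMex α β = lemma (<-wellFounded α) (<-wellFounded β)
    where
    lemma : (x : Acc _<_ α) (y : Acc _<_ β) →
      IsMex (λ γ → (∃[ α′ ] α′ < α × γ ≈ α′ ⊕ β) ⊎ (∃[ β′ ] β′ < β × γ ≈ α ⊕ β′))
            (nimSum α β x y)
    lemma (acc r) (acc s) = let outside , inside = mex-isMex _ in
      (λ where
        (inj₁ (α′ , α′<α , e)) → let a , d = el-surjective α α′<α in
          outside (inj₁ a , ≈-trans e (nimSum-cong d (≈-refl β) _ _ _ _))
        (inj₂ (β′ , β′<β , e)) → let b , d = el-surjective β β′<β in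
          outside (inj₂ b , ≈-trans e (nimSum-cong (≈-refl α) d _ _ _ _))) ,
      λ γ γ<m → case-option γ (inside γ γ<m)
      where
      case-option : ∀ γ → _ → _
      case-option γ (inj₁ a , e) = inj₁ (el α a , el< α a ,
        ≈-trans e (nimSum-cong (≈-refl (el α a)) (≈-refl β) _ _ _ _))
      case-option γ (inj₂ b , e) = inj₂ (el β b , el< β b ,
        ≈-trans e (nimSum-cong (≈-refl α) (≈-refl (el β b)) _ _ _ _))

  ⊗-isMex : (α β : Ord ℓ) →
    IsMex (λ γ → ∃[ α′ ] ∃[ β′ ] α′ < α × β′ < β ×
                 γ ≈ (α′ ⊗ β) ⊕ (α ⊗ β′) ⊕ (α′ ⊗ β′))
          (α ⊗ β)
  ⊗-isMex α β = lemma (<-wellFounded α) (<-wellFounded β)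
    where
    lemma : (x : Acc _<_ α) (y : Acc _<_ β) →
      IsMex (λ γ → ∃[ α′ ] ∃[ β′ ] α′ < α × β′ < β ×
                   γ ≈ (α′ ⊗ β) ⊕ (α ⊗ β′) ⊕ (α′ ⊗ β′))
            (nimProduct α β x y)
    lemma (acc r) (acc s) = let outside , inside = mex-isMex _ in
      (λ (α′ , β′ , α′<α , β′<β , e) →
        let a , d = el-surjective α α′<α ; b , d′ = el-surjective β β′<β in
        outside ((a , b) , ≈-trans e (⊕-cong (⊕-cong
          (nimProduct-cong d (≈-refl β) _ _ _ _)
          (nimProduct-cong (≈-refl α) d′ _ _ _ _))
          (nimProduct-cong d d′ _ _ _ _)))) ,
      λ γ γ<m → let (a , b) , e = inside γ γ<m in
        el α a , el β b , el< α a , el< β b , ≈-trans e (⊕-cong (⊕-cong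
          (nimProduct-cong (≈-refl (el α a)) (≈-refl β) _ _ _ _)
          (nimProduct-cong (≈-refl α) (≈-refl (el β b)) _ _ _ _))
          (nimProduct-cong (≈-refl (el α a)) (≈-refl (el β b)) _ _ _ _))

record IsField (R : RawRing c ℓ) : Set (c ⊔ ℓ) where
  open RawRing R renaming (_≈_ to _≈ᴿ_; _≉_ to _≉ᴿ_)
  field
    isCommutativeRing : IsCommutativeRing _≈ᴿ_ _+_ _*_ -_ 0# 1#
    0≉1               : 0# ≉ᴿ 1#
    inverse           : ∀ x → x ≉ᴿ 0# → ∃[ y ] x * y ≈ᴿ 1#

-- A polynomial c₀ + c₁ X + ⋯ + cₙ Xⁿ is its coefficient list c₀ ∷ c₁ ∷ ⋯ ∷ cₙ ∷ [],
-- where trailing zero coefficients are allowed.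

module Polynomial (R : RawRing c ℓ) where
  open RawRing R renaming (_≉_ to _≉ᴿ_)

  Poly : Set c
  Poly = List Carrier

  ⟦_⟧ : Poly → Carrier → Carrier
  ⟦ [] ⟧     x = 0#
  ⟦ a ∷ as ⟧ x = a + x * ⟦ as ⟧ x

  NonZero : Poly → Set (c ⊔ ℓ)
  NonZero = Any (_≉ᴿ 0#)

  NonConstant : Poly → Set (c ⊔ ℓ)
  NonConstant []       = ⊥
  NonConstant (_ ∷ as) = NonZero as

IsAlgebraicallyClosed : RawRing c ℓ → Set (c ⊔ ℓ)
IsAlgebraicallyClosed R = ∀ p → NonConstant p → ∃[ x ] ⟦ p ⟧ x ≈ᴿ 0#
  where
  open RawRing R renaming (_≈_ to _≈ᴿ_)
  open Polynomial R

module _ (K : RawRing a b) (L : RawRing c ℓ) where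
  private
    module K = RawRing K
    module L = RawRing L
    module K[X] = Polynomial K
    module L[X] = Polynomial L

  IsAlgebraicOver : (K.Carrier → L.Carrier) → L.Carrier → Set (a ⊔ b ⊔ ℓ)
  IsAlgebraicOver ι x =
    Σ K[X].Poly λ p → K[X].NonZero p × L[X].⟦ map ι p ⟧ x L.≈ L.0#

  record IsAlgebraicClosure (ι : K.Carrier → L.Carrier) :
         Set (a ⊔ b ⊔ c ⊔ ℓ) where
    field
      isField-base          : IsField K
      isField               : IsField L
      isRingHomomorphism    : RingMorphisms.IsRingHomomorphism K L ι
      algebraic             : ∀ x → IsAlgebraicOver ι x
      isAlgebraicallyClosed : IsAlgebraicallyClosed L

-- Negation is the identity since the characteristic is 2.

On₂ : (ℓ : Level) → RawRing (suc ℓ) ℓ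
On₂ ℓ = record
  { Carrier = Ord ℓ
  ; _≈_     = _≈_
  ; _+_     = _⊕_
  ; _*_     = _⊗_
  ; -_      = id
  ; 0#      = 𝟘
  ; 1#      = 𝟙
  }

-- u is a subfield of On₂: the set of ordinals below u is closed under the
-- operations of On₂ and is a field under their restrictions.  (The ring axioms
-- contained in isField are inherited from On₂, so they add no restriction on u.)

record IsFieldOrdinal (u : Ord ℓ) : Set (suc ℓ) where
  field
    𝟘<u      : 𝟘 < u
    𝟙<u      : 𝟙 < u
    ⊕-closed : ∀ {α β} → α < u → β < u → α ⊕ β < u
    ⊗-closed : ∀ {α β} → α < u → β < u → α ⊗ β < u

  restriction : RawRing (suc ℓ) ℓ
  restriction = record
    { Carrier = ∃[ α ] α < u
    ; _≈_     = λ (α , _) (β , _) → α ≈ β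
    ; _+_     = λ (α , p) (β , q) → α ⊕ β , ⊕-closed p q
    ; _*_     = λ (α , p) (β , q) → α ⊗ β , ⊗-closed p q
    ; -_      = id
    ; 0#      = 𝟘 , 𝟘<u
    ; 1#      = 𝟙 , 𝟙<u
    }

  field
    isField : IsField restriction

  Algebraic : Ord ℓ → Set (suc ℓ)
  Algebraic = IsAlgebraicOver restriction (On₂ ℓ) proj₁

inclusion : {u v : Ord ℓ} → u ≤ v → ∃[ α ] α < u → ∃[ α ] α < v
inclusion {u = u} {v} u≤v (α , α<u) = α , <-≤-trans α u v α<u u≤v

{-# OPTIONS --safe #-}

-- Let t be the least ordinal that is not algebraic over u; it exists because the
-- roots of the polynomials over u, which form a set, are bounded.  If t ≤ α ⊕ β with
-- α, β < t, then the mex formula writes t as a sum of α, β or smaller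
-- ordinals, so t would be algebraic; the same argument applies to ⊗, and inverses
-- lie in u[α] ⊆ t.  Hence t is a field, algebraic over u, and transcendental over
-- itself.  That forces every polynomial over t to split over t (see
-- TranscendentalSegment), so t is algebraically closed and contains every ordinal
-- algebraic over u.

module Submission where

open import Algebra.Bundles using (AbelianGroup; CommutativeRing)
import Algebra.Solver.Ring as RingSolver
open import Algebra.Solver.Ring.AlmostCommutativeRing
  using (_-Raw-AlmostCommutative⟶_; fromCommutativeRing)
open import Algebra.Structures using (IsCommutativeRing)
open import Axiom.ExcludedMiddle using (ExcludedMiddle)
open import Data.Bool.Base using (Bool; false; if_then_else_; true; _xor_)
import Data.Bool.Properties as Bool
open import Data.Fin.Patterns
open import Data.List.Base using (List; []; _∷_; _++_; concatMap; length; map)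
open import Data.List.Relation.Binary.Pointwise using (Pointwise; []; _∷_)
open import Data.List.Relation.Unary.All as All using (All; []; _∷_)
open import Data.List.Relation.Unary.Any as Any using (Any; here; there)
import Data.List.Relation.Unary.Any.Properties as Any
open import Data.Maybe.Base using (Maybe; just; nothing)
import Data.Nat.Base as ℕ
import Data.Nat.Properties as ℕ
open import Data.Product using (Σ; ∃; ∃-syntax; _×_; _,_; proj₁; proj₂)
open import Data.Sum using (_⊎_; inj₁; inj₂)
open import Data.Vec.Base using (Vec; []; _∷_; lookup; replicate; zipWith)
open import Function.Base using (case_of_; id; _∘_)
open import Function.Bundles using (_⇔_; mk⇔)
open import Induction.WellFounded using (Acc; acc)
open import Level using (Level; Lift; lift; lower; _⊔_)
open import Relation.Binary.Bundles using (Setoid)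
open import Relation.Binary.Definitions using (Decidable)
open import Relation.Binary.PropositionalEquality as ≡ using (_≡_)
import Relation.Binary.Reasoning.Setoid as SetoidReasoning
open import Relation.Nullary using (¬_; ¬?; Dec; contradiction; no; yes)
open import Relation.Nullary.Decidable using (decidable-stable; map′)
open import Relation.Unary as Unary using (Pred; _⊆_)
open import Defs using (module Polynomial)

-- Algebraicity is used in the form `Integral`: some power of x is a combination of the lower ones.
-- Over a subfield this agrees with being a root of a nonzero polynomial (`root⇒integral`,
-- `integral⇒root`). It reduces sums, products and transitivity to one count of vectors against
-- generators (`steinitz`), without bases or minimal polynomials. Transitivity is what makes t
-- transcendental over the field t and not merely over u. The mex formulas describe only what lies
-- below an ordinal, so they split a monic polynomial of degree n only once its remaining terms are
-- known to have a value below tⁿ at t. The delicate point is therefore the inequality `span<power`.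
-- Excluded middle is assumed one level above the order because the proof decides statements that
-- quantify over all ordinals: whether a polynomial has a root, and whether some smaller ordinal
-- fails to be algebraic.

-- A solver for abelian groups of exponent 2

module BooleanGroupSolver {c ℓ} (G : AbelianGroup c ℓ)
  (self-inverse : ∀ x → AbelianGroup._≈_ G (AbelianGroup._∙_ G x x) (AbelianGroup.ε G))
  where

  open import Data.Nat.Base using (ℕ; zero; suc)
  open import Data.Fin.Base using (Fin; zero; suc)
  open AbelianGroup G renaming (refl to ≈refl; sym to ≈sym; trans to ≈trans)
  open SetoidReasoning setoid

  infixl 6 _:+_

  data Expr (n : ℕ) : Set where
    var  : Fin n → Expr n
    _:+_ : Expr n → Expr n → Expr n

  ⟦_⟧ₑ : ∀ {n} → Expr n → Vec Carrier n → Carrier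
  ⟦ var i ⟧ₑ  ρ = lookup ρ i
  ⟦ e :+ f ⟧ₑ ρ = ⟦ e ⟧ₑ ρ ∙ ⟦ f ⟧ₑ ρ

  singleton : ∀ {n} → Fin n → Vec Bool n
  singleton zero    = true ∷ replicate _ false
  singleton (suc i) = false ∷ singleton i

  -- In a group of exponent 2 a sum depends only on the parity with which each variable occurs.
  normalise : ∀ {n} → Expr n → Vec Bool n
  normalise (var i)  = singleton i
  normalise (e :+ f) = zipWith _xor_ (normalise e) (normalise f)

  ⟦_⟧ₙ : ∀ {n} → Vec Bool n → Vec Carrier n → Carrier
  ⟦ [] ⟧ₙ        []      = ε
  ⟦ true ∷ v ⟧ₙ  (x ∷ ρ) = x ∙ ⟦ v ⟧ₙ ρ
  ⟦ false ∷ v ⟧ₙ (x ∷ ρ) = ⟦ v ⟧ₙ ρ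

  empty-correct : ∀ {n} (ρ : Vec Carrier n) → ⟦ replicate n false ⟧ₙ ρ ≈ ε
  empty-correct []      = ≈refl
  empty-correct (x ∷ ρ) = empty-correct ρ

  singleton-correct : ∀ {n} (i : Fin n) ρ → ⟦ singleton i ⟧ₙ ρ ≈ lookup ρ i
  singleton-correct zero    (x ∷ ρ) = ≈trans (∙-congˡ (empty-correct ρ)) (identityʳ x)
  singleton-correct (suc i) (x ∷ ρ) = singleton-correct i ρ

  xor-correct : ∀ {n} (v w : Vec Bool n) ρ →
                ⟦ zipWith _xor_ v w ⟧ₙ ρ ≈ ⟦ v ⟧ₙ ρ ∙ ⟦ w ⟧ₙ ρ
  xor-correct []          []          []      = ≈sym (identityˡ ε)
  xor-correct (false ∷ v) (false ∷ w) (x ∷ ρ) = xor-correct v w ρ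
  xor-correct (true ∷ v)  (false ∷ w) (x ∷ ρ) =
    ≈trans (∙-congˡ (xor-correct v w ρ)) (≈sym (assoc x _ _))
  xor-correct (false ∷ v) (true ∷ w)  (x ∷ ρ) = begin
    x ∙ ⟦ zipWith _xor_ v w ⟧ₙ ρ   ≈⟨ ∙-congˡ (xor-correct v w ρ) ⟩
    x ∙ (⟦ v ⟧ₙ ρ ∙ ⟦ w ⟧ₙ ρ)      ≈⟨ assoc x _ _ ⟨
    x ∙ ⟦ v ⟧ₙ ρ ∙ ⟦ w ⟧ₙ ρ        ≈⟨ ∙-congʳ (comm x _) ⟩
    ⟦ v ⟧ₙ ρ ∙ x ∙ ⟦ w ⟧ₙ ρ        ≈⟨ assoc _ x _ ⟩
    ⟦ v ⟧ₙ ρ ∙ (x ∙ ⟦ w ⟧ₙ ρ)      ∎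
  xor-correct (true ∷ v)  (true ∷ w)  (x ∷ ρ) = begin
    ⟦ zipWith _xor_ v w ⟧ₙ ρ           ≈⟨ xor-correct v w ρ ⟩
    ⟦ v ⟧ₙ ρ ∙ ⟦ w ⟧ₙ ρ                ≈⟨ ∙-congʳ (identityˡ _) ⟨
    ε ∙ ⟦ v ⟧ₙ ρ ∙ ⟦ w ⟧ₙ ρ            ≈⟨ ∙-congʳ (∙-congʳ (self-inverse x)) ⟨
    x ∙ x ∙ ⟦ v ⟧ₙ ρ ∙ ⟦ w ⟧ₙ ρ        ≈⟨ ∙-congʳ (assoc x x _) ⟩
    x ∙ (x ∙ ⟦ v ⟧ₙ ρ) ∙ ⟦ w ⟧ₙ ρ      ≈⟨ ∙-congʳ (∙-congˡ (comm x _)) ⟩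
    x ∙ (⟦ v ⟧ₙ ρ ∙ x) ∙ ⟦ w ⟧ₙ ρ      ≈⟨ ∙-congʳ (assoc x _ x) ⟨
    x ∙ ⟦ v ⟧ₙ ρ ∙ x ∙ ⟦ w ⟧ₙ ρ        ≈⟨ assoc _ x _ ⟩
    x ∙ ⟦ v ⟧ₙ ρ ∙ (x ∙ ⟦ w ⟧ₙ ρ)      ∎

  normalise-correct : ∀ {n} (e : Expr n) ρ → ⟦ normalise e ⟧ₙ ρ ≈ ⟦ e ⟧ₑ ρ
  normalise-correct (var i)  ρ = singleton-correct i ρ
  normalise-correct (e :+ f) ρ = ≈trans (xor-correct (normalise e) (normalise f) ρ)
    (∙-cong (normalise-correct e ρ) (normalise-correct f ρ))

  solve : ∀ {n} (ρ : Vec Carrier n) (e f : Expr n) → normalise e ≡ normalise f →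
          ⟦ e ⟧ₑ ρ ≈ ⟦ f ⟧ₑ ρ
  solve ρ e f eq = ≈trans (≈sym (normalise-correct e ρ))
    (≈trans (reflexive (≡.cong (λ v → ⟦ v ⟧ₙ ρ) eq)) (normalise-correct f ρ))

-- Commutative algebra in a domain of characteristic 2

module DomainOfCharacteristicTwo {c ℓ} (R : CommutativeRing c ℓ)
  (+-self : ∀ x → CommutativeRing._≈_ R (CommutativeRing._+_ R x x) (CommutativeRing.0# R))
  (_≟_ : Decidable (CommutativeRing._≈_ R))
  (*-nonzero : ∀ {x y} → ¬ CommutativeRing._≈_ R x (CommutativeRing.0# R) →
                         ¬ CommutativeRing._≈_ R y (CommutativeRing.0# R) →
                         ¬ CommutativeRing._≈_ R (CommutativeRing._*_ R x y) (CommutativeRing.0# R))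
  where

  open import Data.Nat.Base as ℕ using (ℕ; zero; suc)
  open CommutativeRing R
  open import Algebra.Properties.Semiring.Exp semiring using (_^_)
  open SetoidReasoning setoid
  open Polynomial rawRing using (⟦_⟧)

  private
    variable
      p q : Level
      n : ℕ
      k x y z : Carrier
      as bs cs xs : List Carrier
      P Q : Pred Carrier p

  bit : Bool → Carrier
  bit true  = 1#
  bit false = 0#

  -0≈0 : - 0# ≈ 0#
  -0≈0 = trans (sym (+-identityˡ (- 0#))) (-‿inverseʳ 0#)

  -1≈1 : - 1# ≈ 1#
  -1≈1 = begin
    - 1#                 ≈⟨ +-identityˡ _ ⟨
    0# + - 1#            ≈⟨ +-congʳ (+-self 1#) ⟨
    1# + 1# + - 1#       ≈⟨ +-assoc _ _ _ ⟩
    1# + (1# + - 1#)     ≈⟨ +-congˡ (-‿inverseʳ 1#) ⟩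
    1# + 0#              ≈⟨ +-identityʳ 1# ⟩
    1#                   ∎

  bit-homomorphism : CommutativeRing.rawRing Bool.xor-∧-commutativeRing
                     -Raw-AlmostCommutative⟶ fromCommutativeRing R
  bit-homomorphism = record
    { ⟦_⟧    = bit
    ; +-homo = λ where
        true  true  → sym (+-self 1#)
        true  false → sym (+-identityʳ 1#)
        false b     → sym (+-identityˡ (bit b))
    ; *-homo = λ where
        true  b → sym (*-identityˡ (bit b))
        false b → sym (zeroˡ (bit b))
    ; -‿homo = λ where
        true  → sym -1≈1
        false → sym -0≈0
    ; 0-homo = refl
    ; 1-homo = refl
    }

  bit-≟ : ∀ a b → Maybe (bit a ≈ bit b)
  bit-≟ true  true  = just refl
  bit-≟ false false = just refl
  bit-≟ _     _     = nothing

  -- With coefficients in ℤ/2 the solver proves the identities valid in characteristic 2.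
  open RingSolver _ (fromCommutativeRing R) bit-homomorphism bit-≟
    using (solve; _:=_; con; _:+_; _:*_)

  +≈0⇒≈ : x + y ≈ 0# → x ≈ y
  +≈0⇒≈ {x} {y} e = begin
    x          ≈⟨ solve 2 (λ x y → x := x :+ y :+ y) refl x y ⟩
    x + y + y  ≈⟨ +-congʳ e ⟩
    0# + y     ≈⟨ +-identityˡ y ⟩
    y          ∎

  *-cancelˡ-0 : ¬ x ≈ 0# → x * y ≈ 0# → y ≈ 0#
  *-cancelˡ-0 {x} {y} x≉0 e with y ≟ 0#
  ... | yes y≈0 = y≈0
  ... | no  y≉0 = contradiction e (*-nonzero x≉0 y≉0)

  record IsSubring (P : Pred Carrier p) : Set (c ⊔ ℓ ⊔ p) where
    field
      resp     : x ≈ y → P x → P y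
      1∈       : P 1#
      +-closed : P x → P y → P (x + y)
      *-closed : P x → P y → P (x * y)

    0∈ : P 0#
    0∈ = resp (+-self 1#) (+-closed 1∈ 1∈)

  record IsSubfield (P : Pred Carrier p) : Set (c ⊔ ℓ ⊔ p) where
    field
      isSubring : IsSubring P
      inverse   : P x → ¬ x ≈ 0# → ∃[ y ] P y × x * y ≈ 1#

    open IsSubring isSubring public

  -- Linear combinations

  data Span (P : Pred Carrier p) : List Carrier → Pred Carrier (c ⊔ ℓ ⊔ p) where
    nil  : x ≈ 0# → Span P [] x
    cons : ∀ {b} → P k → Span P bs y → x ≈ k * b + y → Span P (b ∷ bs) x

  span-resp : x ≈ y → Span P bs x → Span P bs y
  span-resp e (nil d)       = nil (trans (sym e) d)
  span-resp e (cons Pk s d) = cons Pk s (trans (sym e) d)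

  span-mono : P ⊆ Q → Span P bs ⊆ Span Q bs
  span-mono P⊆Q (nil e)       = nil e
  span-mono P⊆Q (cons Pk s e) = cons (P⊆Q Pk) (span-mono P⊆Q s) e

  module _ (S : IsSubring P) where
    open IsSubring S

    span-0 : ∀ bs → Span P bs 0#
    span-0 []       = nil refl
    span-0 (b ∷ bs) = cons 0∈ (span-0 bs)
      (solve 1 (λ b → con false := con false :* b :+ con false) refl b)

    span-+ : Span P bs x → Span P bs y → Span P bs (x + y)
    span-+ (nil e) (nil d) = nil (trans (+-cong e d) (+-identityˡ 0#))
    span-+ (cons {k} {y = y} {b = b} Pk s e) (cons {k′} {y = y′} Pk′ s′ e′) =
      cons (+-closed Pk Pk′) (span-+ s s′) (trans (+-cong e e′)
        (solve 5 (λ k k′ b y y′ → (k :* b :+ y) :+ (k′ :* b :+ y′) :=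
                                  (k :+ k′) :* b :+ (y :+ y′)) refl k k′ b y y′))

    span-* : P k → Span P bs x → Span P bs (k * x)
    span-* {k} Pk (nil e) = nil (trans (*-congˡ e) (zeroʳ k))
    span-* {k} Pk (cons {k′} {y = y} {b = b} Pk′ s e) =
      cons (*-closed Pk Pk′) (span-* Pk s) (trans (*-congˡ e)
        (solve 4 (λ k k′ b y → k :* (k′ :* b :+ y) := k :* k′ :* b :+ k :* y) refl k k′ b y))

    span-there : ∀ {b} → Span P bs x → Span P (b ∷ bs) x
    span-there {x = x} {b = b} s =
      cons 0∈ s (solve 2 (λ b x → x := con false :* b :+ x) refl b x)

    span-here : ∀ {b} → Span P (b ∷ bs) b
    span-here {bs = bs} {b} =
      cons 1∈ (span-0 bs) (solve 1 (λ b → b := con true :* b :+ con false) refl b)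

    span-members : ∀ bs → All (Span P bs) bs
    span-members []       = []
    span-members (b ∷ bs) = span-here ∷ All.map span-there (span-members bs)

    span-⊆ : All (Span P cs) bs → Span P bs ⊆ Span P cs
    span-⊆ {cs = cs} []       (nil e)       = span-resp (sym e) (span-0 cs)
    span-⊆           (b ∷ bs) (cons Pk s e) =
      span-resp (sym e) (span-+ (span-* Pk b) (span-⊆ bs s))

    span-++ : ∀ bs → Span P bs x → Span P cs y → Span P (bs ++ cs) (x + y)
    span-++ {y = y} [] (nil e) s =
      span-resp (sym (trans (+-congʳ e) (+-identityˡ y))) s
    span-++ {y = y} (b ∷ bs) (cons {k} {y = w} Pk s e) s′ =
      cons Pk (span-++ bs s s′) (trans (+-congʳ e) (+-assoc _ _ _))

    span-scale : ∀ z → Span P bs x → Span P (map (_* z) bs) (x * z)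
    span-scale z (nil e) = nil (trans (*-congʳ e) (zeroˡ z))
    span-scale z (cons {k} {y = y} {b = b} Pk s e) = cons Pk (span-scale z s)
      (trans (*-congʳ e) (solve 4 (λ k b y z → (k :* b :+ y) :* z := k :* (b :* z) :+ y :* z)
        refl k b y z))

    -- Expanding every coefficient from `Q` over `bs` leaves combinations of the products; this is
    -- the upper bound in the multiplicativity of degrees.
    span-tower : ∀ bs cs → Q ⊆ Span P bs →
                 Span Q cs ⊆ Span P (concatMap (λ z → map (_* z) bs) cs)
    span-tower bs []       Q⊆ (nil e)       = nil e
    span-tower bs (z ∷ cs) Q⊆ (cons Qk s e) = span-resp (sym e)
      (span-++ (map (_* z) bs) (span-scale z (Q⊆ Qk)) (span-tower bs cs Q⊆ s))

  -- Powers, integrality and adjunction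

  powers : Carrier → ℕ → List Carrier
  powers x zero    = []
  powers x (suc n) = x ^ n ∷ powers x n

  -- Integrality in the usual sense: x is a root of a monic polynomial of degree n. The case n = 0
  -- would say that 1 is 0.
  Integral : Pred Carrier p → Pred Carrier (c ⊔ ℓ ⊔ p)
  Integral P x = ∃[ n ] Span P (powers x n) (x ^ n)

  integral-mono : P ⊆ Q → Integral P ⊆ Integral Q
  integral-mono P⊆Q (n , s) = n , span-mono P⊆Q s

  module _ (S : IsSubring P) where
    open IsSubring S

    ^-closed : P x → ∀ n → P (x ^ n)
    ^-closed Px zero    = 1∈
    ^-closed Px (suc n) = *-closed Px (^-closed Px n)

    span-powers-closed : Q ⊆ P → P x → ∀ n → Span Q (powers x n) ⊆ P
    span-powers-closed Q⊆P Px zero    (nil e)       = resp (sym e) 0∈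
    span-powers-closed Q⊆P Px (suc n) (cons Qk s e) = resp (sym e)
      (+-closed (*-closed (Q⊆P Qk) (^-closed Px n)) (span-powers-closed Q⊆P Px n s))

    powers-shift : ∀ n → Span P (powers x n) y → Span P (powers x (suc n)) (x * y)
    powers-shift {x} zero    (nil e)   = span-resp (sym (trans (*-congˡ e) (zeroʳ x))) (span-0 S _)
    powers-shift {x} (suc n) (cons {k} {y = y} Pk s e) = cons Pk (powers-shift n s)
      (trans (*-congˡ e) (solve 4 (λ x k b y → x :* (k :* b :+ y) := k :* (x :* b) :+ x :* y)
        refl x k (x ^ n) y))

    powers-const : P k → ∀ n → Span P (powers x (suc n)) k
    powers-const Pk zero    =
      cons Pk (nil refl) (solve 1 (λ k → k := k :* con true :+ con false) refl _)
    powers-const Pk (suc n) = span-there S (powers-const Pk n)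

    -- Splits off the constant term. The powers are listed in descending order, so that term sits at
    -- the far end and has to be carried outwards by recursion.
    powers-unshift : ∀ n → Span P (powers x (suc n)) y →
                     ∃[ k ] ∃[ z ] P k × Span P (powers x n) z × y ≈ k + x * z
    powers-unshift {x} zero (cons {k} Pk (nil e) d) = k , 0# , Pk , nil refl ,
      trans d (trans (+-congˡ e)
        (solve 2 (λ k x → k :* con true :+ con false := k :+ x :* con false) refl k x))
    powers-unshift {x} (suc n) (cons {k} Pk s e) with powers-unshift n s
    ... | k′ , z , Pk′ , s′ , d = k′ , k * x ^ n + z , Pk′ , cons Pk s′ refl ,
      trans e (trans (+-congˡ d) (solve 5
        (λ x k b k′ z → k :* (x :* b) :+ (k′ :+ x :* z) := k′ :+ x :* (k :* b :+ z))
        refl x k (x ^ n) k′ z))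

    module Adjoin {x} (n : ℕ) (x^n∈ : Span P (powers x n) (x ^ n)) where

      P[x] : Pred Carrier _
      P[x] = Span P (powers x n)

      x*-closed : P[x] y → P[x] (x * y)
      -- Shifting produces at most the one new power xⁿ, which `x^n∈` expresses through the lower
      -- ones.
      x*-closed s = span-⊆ S (x^n∈ ∷ span-members S _) (powers-shift n s)

      ^*-closed : ∀ m → P[x] y → P[x] (x ^ m * y)
      ^*-closed zero    s = span-resp (sym (*-identityˡ _)) s
      ^*-closed (suc m) s = span-resp (sym (*-assoc _ _ _)) (x*-closed (^*-closed m s))

      closed : ∀ m → Span P (powers x m) y → P[x] z → P[x] (y * z)
      closed {z = z} zero    (nil e) s = span-resp (sym (trans (*-congʳ e) (zeroˡ z))) (span-0 S _)
      closed {z = z} (suc m) (cons {k} {y = y} Pk t e) s = span-resp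
        (sym (trans (*-congʳ e) (solve 4 (λ k b y z → (k :* b :+ y) :* z := k :* (b :* z) :+ y :* z)
          refl k (x ^ m) y z)))
        (span-+ S (span-* S Pk (^*-closed m s)) (closed m t s))

      1∈P[x] : ∀ m → Span P (powers x m) (x ^ m) → Span P (powers x m) 1#
      -- In degree 0 the relation for `x ^ 0` is itself the membership of 1.
      1∈P[x] zero    s = s
      1∈P[x] (suc m) _ = powers-const 1∈ m

      isSubring : IsSubring P[x]
      isSubring = record
        { resp     = span-resp
        ; 1∈       = 1∈P[x] n x^n∈
        ; +-closed = span-+ S
        ; *-closed = closed n
        }

      P⊆P[x] : P ⊆ P[x]
      P⊆P[x] {k} Pk = span-resp (*-identityʳ k) (span-* S Pk (1∈P[x] n x^n∈))

      x∈P[x] : P[x] x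
      x∈P[x] = span-resp (*-identityʳ x) (x*-closed (1∈P[x] n x^n∈))

  -- One member is a combination of the later ones; for the descending powers of x
  -- this amounts to integrality of x.
  data Dependent (K : Pred Carrier p) : Pred (List Carrier) (c ⊔ ℓ ⊔ p) where
    here  : Span K xs x → Dependent K (x ∷ xs)
    there : Dependent K xs → Dependent K (x ∷ xs)

  dependent-powers⇒integral : ∀ n → Dependent P (powers x n) → Integral P x
  dependent-powers⇒integral (suc n) (here s)  = n , s
  dependent-powers⇒integral (suc n) (there d) = dependent-powers⇒integral n d

  -- Exchange and finite extensions over a subfield

  module OverSubfield {p} {K : Pred Carrier p} (F : IsSubfield K) where
    open IsSubfield F renaming (isSubring to S)

    -- An element v of the span of xs with b-coefficient 1, and the list ys obtained by
    -- using it to clear b from the other members of xs.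
    record Pivot (b : Carrier) (bs xs : List Carrier) : Set (c ⊔ ℓ ⊔ p) where
      field
        v            : Carrier
        v∈           : Span K xs v
        b+v∈         : Span K bs (b + v)
        ys           : List Carrier
        ys⊆          : All (Span K bs) ys
        ys⊆xs        : All (Span K xs) ys
        length-ys    : length xs ≡ suc (length ys)
        dependent-ys : Dependent K ys → Dependent K xs

    -- One step of Gaussian elimination. The tail is searched first, so every member is corrected by
    -- a pivot that comes after it. This order matters because `Dependent` asks for a combination of
    -- later members.
    eliminate : ∀ b bs xs → All (Span K (b ∷ bs)) xs →
                All (Span K bs) xs ⊎ Pivot b bs xs
    eliminate b bs []       []       = inj₁ []
    eliminate b bs (x ∷ xs) (cons {k} {y = y} Kk s e ∷ ss) with eliminate b bs xs ss
    ... | inj₂ pivot = inj₂ record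
      { v            = v
      ; v∈           = span-there S v∈
      ; b+v∈         = b+v∈
      ; ys           = x + k * v ∷ ys
      ; ys⊆          = span-resp
          (trans (solve 4 (λ k b y v → k :* (b :+ v) :+ y := k :* b :+ y :+ k :* v) refl k b y v)
                 (+-congʳ (sym e)))
          (span-+ S (span-* S Kk b+v∈) s) ∷ ys⊆
      ; ys⊆xs        = span-+ S (span-here S) (span-there S (span-* S Kk v∈)) ∷
                       All.map (span-there S) ys⊆xs
      ; length-ys    = ≡.cong suc length-ys
      ; dependent-ys = λ where
          -- Adding `k * v` a second time undoes the correction and recovers x; v itself is a
          -- combination of later members.
          (here d)  → here (span-resp
            (solve 3 (λ x k v → x :+ k :* v :+ k :* v := x) refl x k v)
            (span-+ S (span-⊆ S ys⊆xs d) (span-* S Kk v∈)))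
          (there d) → there (dependent-ys d)
      }
      where open Pivot pivot
    ... | inj₁ xs⊆ with k ≟ 0#
    ...   | yes k≈0 = inj₁ (span-resp (sym (trans e (trans (+-congʳ (trans (*-congʳ k≈0) (zeroˡ b)))
                                                           (+-identityˡ y)))) s ∷ xs⊆)
    ...   | no  k≉0 with inverse Kk k≉0
    ...     | k⁻¹ , Kk⁻¹ , kk⁻¹≈1 = inj₂ record
      { v            = k⁻¹ * x
      ; v∈           = span-* S Kk⁻¹ (span-here S)
      -- Since x is k b + y, the term b cancels from b + k⁻¹ x and leaves k⁻¹ y.
      ; b+v∈         = span-resp (begin
          k⁻¹ * y
            ≈⟨ solve 3 (λ b j y → j :* y := b :+ (con true :* b :+ j :* y)) refl b k⁻¹ y ⟩
          b + (1# * b + k⁻¹ * y)           ≈⟨ +-congˡ (+-congʳ (*-congʳ kk⁻¹≈1)) ⟨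
          b + (k * k⁻¹ * b + k⁻¹ * y)
            ≈⟨ solve 4 (λ b k j y → b :+ (k :* j :* b :+ j :* y) := b :+ j :* (k :* b :+ y))
                 refl b k k⁻¹ y ⟩
          b + k⁻¹ * (k * b + y)            ≈⟨ +-congˡ (*-congˡ e) ⟨
          b + k⁻¹ * x                      ∎)
          (span-* S Kk⁻¹ s)
      ; ys           = xs
      ; ys⊆          = xs⊆
      ; ys⊆xs        = All.map (span-there S) (span-members S xs)
      ; length-ys    = ≡.refl
      ; dependent-ys = there
      }

    -- Each step gives up one generator at the cost of at most one vector, so the surplus of vectors
    -- survives until no generators are left.
    steinitz : ∀ bs xs → All (Span K bs) xs → length bs ℕ.< length xs → Dependent K xs
    steinitz []       (x ∷ xs) (nil e ∷ _) _  = here (span-resp (sym e) (span-0 S xs))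
    steinitz (b ∷ bs) xs       xs⊆         lt with eliminate b bs xs xs⊆
    ... | inj₁ xs⊆bs = steinitz bs xs xs⊆bs (ℕ.<-trans (ℕ.n<1+n _) lt)
    ... | inj₂ pivot = dependent-ys
      (steinitz bs ys ys⊆ (ℕ.≤-pred (≡.subst (suc (length bs) ℕ.<_) length-ys lt)))
      where open Pivot pivot

    -- This is an upper bound on the degree: the span of `generators` contains `E` but may exceed
    -- it.
    record IsFiniteExtension {e} (E : Pred Carrier e) : Set (c ⊔ ℓ ⊔ p ⊔ e) where
      field
        isSubring  : IsSubring E
        K⊆E        : K ⊆ E
        generators : List Carrier
        spanned    : E ⊆ Span K generators

    length-powers : ∀ x n → length (powers x n) ≡ n
    length-powers x zero    = ≡.refl
    length-powers x (suc n) = ≡.cong suc (length-powers x n)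

    -- One more power of x than there are generators forces a dependence among the powers.
    finite⇒integral : {E : Pred Carrier q} → IsFiniteExtension E → E ⊆ Integral K
    finite⇒integral ext {x} Ex = dependent-powers⇒integral m
      (steinitz generators (powers x m) (powers∈ m)
        (≡.subst (length generators ℕ.<_) (≡.sym (length-powers x m)) (ℕ.n<1+n _)))
      where
      open IsFiniteExtension ext
      m = suc (length generators)
      powers∈ : ∀ n → All (Span K generators) (powers x n)
      powers∈ zero    = []
      powers∈ (suc n) = spanned (^-closed isSubring Ex n) ∷ powers∈ n

    adjoin : {E : Pred Carrier q} → IsFiniteExtension E → (n : ℕ) →
             Span E (powers x n) (x ^ n) → IsFiniteExtension (Span E (powers x n))
    adjoin {x = x} ext n x^n∈ = record
      { isSubring  = E[x].isSubring
      ; K⊆E        = E[x].P⊆P[x] ∘ K⊆E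
      ; generators = _
      ; spanned    = span-tower S generators (powers x n) spanned
      }
      where
      open IsFiniteExtension ext
      module E[x] = Adjoin isSubring n x^n∈

    trivial : IsFiniteExtension K
    trivial = record
      { isSubring  = S
      ; K⊆E        = id
      ; generators = 1# ∷ []
      ; spanned    = λ {k} Kk → cons Kk (nil refl)
          (solve 1 (λ k → k := k :* con true :+ con false) refl k)
      }

    module _ (Kx : Integral K x) (Ky : Integral K y) where
      private
        K[x] = adjoin trivial (proj₁ Kx) (proj₂ Kx)
        y∈ = proj₂ (integral-mono (IsFiniteExtension.K⊆E K[x]) Ky)
        K[x,y] = adjoin K[x] (proj₁ Ky) y∈
        module K[x] = Adjoin S (proj₁ Kx) (proj₂ Kx)
        module K[x,y] = Adjoin K[x].isSubring (proj₁ Ky) y∈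
        open IsSubring K[x,y].isSubring using () renaming (+-closed to +∈; *-closed to *∈)

      -- The sum lies in the finite extension K[x, y], so no equation for it has to be computed.
      integral-+ : Integral K (x + y)
      integral-+ = finite⇒integral K[x,y] (+∈ (K[x,y].P⊆P[x] K[x].x∈P[x]) K[x,y].x∈P[x])

      integral-* : Integral K (x * y)
      integral-* = finite⇒integral K[x,y] (*∈ (K[x,y].P⊆P[x] K[x].x∈P[x]) K[x,y].x∈P[x])

    const-integral : K ⊆ Integral K
    const-integral = finite⇒integral trivial

    integral-resp : x ≈ y → Integral K x → Integral K y
    integral-resp e Kx@(n , s) = finite⇒integral (adjoin trivial n s)
      (span-resp e (Adjoin.x∈P[x] S n s))

    -- Only finitely many coefficients occur in a combination; adjoin them one by one.
    collect : {E : Pred Carrier (c ⊔ ℓ ⊔ p)} {L : Pred Carrier q} → IsFiniteExtension E →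
              L ⊆ Integral K → Span L bs x →
              Σ (Pred Carrier (c ⊔ ℓ ⊔ p)) λ E′ → IsFiniteExtension E′ × E ⊆ E′ × Span E′ bs x
    collect {E = E} ext L⊆ (nil e) = E , ext , id , nil e
    collect {E = E} ext L⊆ (cons Lk s e) =
      let n , k∈         = integral-mono (IsFiniteExtension.K⊆E ext) (L⊆ Lk)
          module E[k]    = Adjoin (IsFiniteExtension.isSubring ext) n k∈
          E′ , ext′ , E[k]⊆E′ , s′ = collect (adjoin ext n k∈) L⊆ s
      in E′ , ext′ , E[k]⊆E′ ∘ E[k].P⊆P[x] , cons (E[k]⊆E′ E[k].x∈P[x]) s′ e

    integral-trans : {L : Pred Carrier q} → L ⊆ Integral K → Integral L ⊆ Integral K
    integral-trans L⊆ (n , s) =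
      -- The start is K[1], which is K again, but at the universe level of `Span` that `collect`
      -- keeps through all its adjunctions.
      let E , ext , _ , s′ = collect (adjoin trivial 1 1∈K[1]) L⊆ s
      in finite⇒integral (adjoin ext n s′) (Adjoin.x∈P[x] (IsFiniteExtension.isSubring ext) n s′)
      where
      1∈K[1] : Span K (powers 1# 1) (1# ^ 1)
      1∈K[1] = powers-const S {x = 1#} (*-closed 1∈ 1∈) 0

    -- Write xⁿ⁺¹ = k + x z.  If k ≠ 0, then x (xⁿ + z) = k is invertible; if k = 0,
    -- cancel x and lower the degree.
    integral-inverse : {P : Pred Carrier q} → IsSubring P → K ⊆ P →
                       P x → Integral K x → ¬ x ≈ 0# → ∃[ y ] P y × x * y ≈ 1#
    integral-inverse {x = x} {P = P} SP K⊆P Px (n , s) x≉0 = go n s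
      where
      module SP = IsSubring SP
      go : ∀ n → Span K (powers x n) (x ^ n) → ∃[ y ] P y × x * y ≈ 1#
      go zero (nil 1≈0) =
        contradiction (trans (sym (*-identityʳ x)) (trans (*-congˡ 1≈0) (zeroʳ x))) x≉0
      go (suc n) s with powers-unshift S n s
      ... | k , z , Kk , z∈ , e with k ≟ 0#
      ...   | yes k≈0 = go n (span-resp (sym (+≈0⇒≈ (*-cancelˡ-0 x≉0 (begin
        x * (x ^ n + z)          ≈⟨ distribˡ x _ _ ⟩
        x * x ^ n + x * z        ≈⟨ +-congʳ (trans e (+-congʳ k≈0)) ⟩
        0# + x * z + x * z
          ≈⟨ solve 2 (λ x z → con false :+ x :* z :+ x :* z := con false) refl x z ⟩
        0#                       ∎)))) z∈)
      ...   | no  k≉0 with inverse Kk k≉0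
      ...     | k⁻¹ , Kk⁻¹ , kk⁻¹≈1 = k⁻¹ * (x ^ n + z) ,
        SP.*-closed (K⊆P Kk⁻¹) (SP.+-closed (^-closed SP Px n) (span-powers-closed SP K⊆P Px n z∈)) ,
        (begin
          x * (k⁻¹ * (x ^ n + z))
            ≈⟨ solve 4 (λ x j b z → x :* (j :* (b :+ z)) := j :* (x :* b :+ x :* z))
                 refl x k⁻¹ (x ^ n) z ⟩
          k⁻¹ * (x * x ^ n + x * z)     ≈⟨ *-congˡ (+-congʳ e) ⟩
          k⁻¹ * (k + x * z + x * z)
            ≈⟨ solve 4 (λ x j k z → j :* (k :+ x :* z :+ x :* z) := k :* j) refl x k⁻¹ k z ⟩
          k * k⁻¹                       ≈⟨ kk⁻¹≈1 ⟩
          1#                            ∎)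

  -- Polynomials, their roots and division by a linear factor

  HasNonZero : Pred (List Carrier) _
  HasNonZero = Any (λ a → ¬ a ≈ 0#)

  hasNonZero? : Unary.Decidable HasNonZero
  hasNonZero? = Any.any? (λ a → ¬? (a ≟ 0#))

  ⟦⟧-zero : ∀ as → ¬ HasNonZero as → ∀ x → ⟦ as ⟧ x ≈ 0#
  ⟦⟧-zero []       _   x = refl
  ⟦⟧-zero (a ∷ as) ¬nz x with a ≟ 0#
  ... | no  a≉0 = contradiction (here a≉0) ¬nz
  ... | yes a≈0 = trans (+-cong a≈0 (*-congˡ (⟦⟧-zero as (¬nz ∘ there) x)))
                        (trans (+-identityˡ _) (zeroʳ x))

  ⟦⟧-constant : ∀ {a} as → ¬ HasNonZero as → ∀ x → ⟦ a ∷ as ⟧ x ≈ a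
  ⟦⟧-constant as ¬nz x =
    trans (+-congˡ (trans (*-congˡ (⟦⟧-zero as ¬nz x)) (zeroʳ x))) (+-identityʳ _)

  head-nonZero : ∀ {a} → HasNonZero (a ∷ as) → ¬ HasNonZero as → ¬ a ≈ 0#
  head-nonZero (here a≉0) _    = a≉0
  head-nonZero (there nz) ¬nz = contradiction nz ¬nz

  eval : List (∃ P) → Carrier → Carrier
  eval f = ⟦ map proj₁ f ⟧

  NonZero : Pred (List (∃ P)) _
  NonZero = Any (λ (a , _) → ¬ a ≈ 0#)

  nonZero? : Unary.Decidable (NonZero {P = P})
  nonZero? = Any.any? (λ (a , _) → ¬? (a ≟ 0#))

  -- Polynomials are compared as functions; `vanishing` later extends an equality of values at a
  -- transcendental point to all arguments.
  IsPolynomial : Pred Carrier p → Pred (Carrier → Carrier) _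
  IsPolynomial P g = Σ (List (∃ P)) λ f → ∀ x → eval f x ≈ g x

  module _ (S : IsSubring P) where
    open IsSubring S

    const-isPolynomial : P k → IsPolynomial P (λ _ → k)
    const-isPolynomial {k} Pk = (k , Pk) ∷ [] , λ x →
      solve 2 (λ k x → k :+ x :* con false := k) refl k x

    +-isPolynomial : ∀ {g h} → IsPolynomial P g → IsPolynomial P h →
                     IsPolynomial P (λ x → g x + h x)
    +-isPolynomial (f , e) (f′ , e′) = add f f′ , λ x →
      trans (add-correct f f′ x) (+-cong (e x) (e′ x))
      where
      add : List (∃ P) → List (∃ P) → List (∃ P)
      add []              f               = f
      add f@(_ ∷ _)       []              = f
      add ((a , Pa) ∷ f) ((b , Pb) ∷ f′) = (a + b , +-closed Pa Pb) ∷ add f f′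

      add-correct : ∀ f f′ x → eval (add f f′) x ≈ eval f x + eval f′ x
      add-correct []              f               x = sym (+-identityˡ _)
      add-correct (_ ∷ _)         []              x = sym (+-identityʳ _)
      add-correct ((a , _) ∷ f) ((b , _) ∷ f′) x =
        trans (+-congˡ (*-congˡ (add-correct f f′ x)))
          (solve 5 (λ a b x g h → a :+ b :+ x :* (g :+ h) := a :+ x :* g :+ (b :+ x :* h))
            refl a b x (eval f x) (eval f′ x))

    scale-isPolynomial : ∀ {g} → P k → IsPolynomial P g → IsPolynomial P (λ x → k * g x)
    scale-isPolynomial {k} Pk (f , e) = scale f , λ x → trans (scale-correct f x) (*-congˡ (e x))
      where
      scale : List (∃ P) → List (∃ P)
      scale []             = []
      scale ((a , Pa) ∷ f) = (k * a , *-closed Pk Pa) ∷ scale f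

      scale-correct : ∀ f x → eval (scale f) x ≈ k * eval f x
      scale-correct []            x = sym (zeroʳ k)
      scale-correct ((a , _) ∷ f) x = trans (+-congˡ (*-congˡ (scale-correct f x)))
        (solve 4 (λ k a x g → k :* a :+ x :* (k :* g) := k :* (a :+ x :* g)) refl k a x (eval f x))

    X*-isPolynomial : ∀ {g} → IsPolynomial P g → IsPolynomial P (λ x → x * g x)
    X*-isPolynomial (f , e) = (0# , 0∈) ∷ f , λ x → trans (+-identityˡ _) (*-congˡ (e x))

    -- The monic polynomial with root list `f`: in characteristic 2 the factor x - a is x + a.
    ∏ : List (∃ P) → Carrier → Carrier
    ∏ []            x = 1#
    ∏ ((a , _) ∷ f) x = (x + a) * ∏ f x

    ∏-isPolynomial : ∀ f → IsPolynomial P (∏ f)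
    ∏-isPolynomial []             = const-isPolynomial 1∈
    ∏-isPolynomial ((a , Pa) ∷ f) with ∏-isPolynomial f
    ... | h with +-isPolynomial (X*-isPolynomial h) (scale-isPolynomial Pa h)
    ...   | f′ , e = f′ , λ x → trans (e x) (sym (distribʳ (∏ f x) x a))

    ∏-zero : ∀ f → ∏ f x ≈ 0# → ¬ 1# ≈ 0# → Any (λ (a , _) → x ≈ a) f
    ∏-zero         []            e 1≉0 = contradiction e 1≉0
    ∏-zero {x = x} ((a , _) ∷ f) e 1≉0 with (x + a) ≟ 0#
    ... | yes x+a≈0 = here (+≈0⇒≈ x+a≈0)
    ... | no  x+a≉0 = there (∏-zero f (*-cancelˡ-0 x+a≉0 e) 1≉0)

    -- Trailing zeros are allowed, so the length does not give the degree; it is found by deciding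
    -- at each coefficient whether a nonzero one follows.
    leading-term : ∀ x (f : List (∃ P)) → NonZero f →
      ∃[ n ] ∃[ k ] ∃[ y ] P k × ¬ k ≈ 0# × Span P (powers x n) y × eval f x ≈ k * x ^ n + y
    leading-term x ((a , Pa) ∷ f) nz with nonZero? f
    ... | yes nz′ =
      let n , k , y , Pk , k≉0 , y∈ , e = leading-term x f nz′
      in suc n , k , a + x * y , Pk , k≉0 ,
         span-+ S (powers-const S Pa n) (powers-shift S n y∈) ,
         trans (+-congˡ (*-congˡ e))
           (solve 5 (λ a x k b y → a :+ x :* (k :* b :+ y) := k :* (x :* b) :+ (a :+ x :* y))
             refl a x k (x ^ n) y)
    ... | no ¬nz′ = 0 , a , 0# , Pa , head-nonZero (Any.map⁺ nz) (¬nz′ ∘ Any.map⁻) , nil refl ,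
      trans (⟦⟧-constant (map proj₁ f) (¬nz′ ∘ Any.map⁻) x)
        (solve 1 (λ a → a := a :* con true :+ con false) refl a)

    span-powers⇒monic : ¬ 1# ≈ 0# → ∀ n → Span P (powers x n) y →
      Σ (List (∃ P)) λ f → NonZero f × eval f x ≈ y + x ^ n
    span-powers⇒monic {x} 1≉0 zero (nil y≈0) = (1# , 1∈) ∷ [] , here 1≉0 ,
      trans (+-congˡ (zeroʳ x)) (trans (+-comm 1# 0#) (+-congʳ (sym y≈0)))
    span-powers⇒monic {x} 1≉0 (suc n) s =
      let k , z , Pk , z∈ , e = powers-unshift S n s
          f , nz , d = span-powers⇒monic 1≉0 n z∈
      in (k , Pk) ∷ f , there nz , trans (+-congˡ (*-congˡ d))
           (trans (solve 4 (λ k x z b → k :+ x :* (z :+ b) := k :+ x :* z :+ x :* b) refl k x z (x ^ n))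
             (+-congʳ (sym e)))

    integral⇒root : ¬ 1# ≈ 0# → Integral P x →
      Σ (List (∃ P)) λ f → NonZero f × eval f x ≈ 0#
    integral⇒root {x} 1≉0 (n , s) =
      let f , nz , e = span-powers⇒monic 1≉0 n s
      in f , nz , trans e (+-self (x ^ n))

  -- Divide by the leading coefficient; this is where `P` has to be a field.
  root⇒integral : IsSubfield P → (f : List (∃ P)) → NonZero f → eval f x ≈ 0# → Integral P x
  root⇒integral {x = x} F f nz e =
    let n , k , y , Pk , k≉0 , y∈ , d = leading-term isSubring x f nz
        k⁻¹ , Pk⁻¹ , kk⁻¹≈1 = inverse Pk k≉0
    in n , span-resp (begin
         k⁻¹ * y
           ≈⟨ solve 3 (λ j y b → j :* y := con true :* b :+ (con true :* b :+ j :* y))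
                refl k⁻¹ y (x ^ n) ⟩
         1# * x ^ n + (1# * x ^ n + k⁻¹ * y)  ≈⟨ +-congˡ (+-congʳ (*-congʳ kk⁻¹≈1)) ⟨
         1# * x ^ n + (k * k⁻¹ * x ^ n + k⁻¹ * y)
           ≈⟨ solve 4 (λ k j y b → con true :* b :+ (k :* j :* b :+ j :* y) := b :+ j :* (k :* b :+ y))
                refl k k⁻¹ y (x ^ n) ⟩
         x ^ n + k⁻¹ * (k * x ^ n + y)    ≈⟨ +-congˡ (*-congˡ (trans (sym d) e)) ⟩
         x ^ n + k⁻¹ * 0#
           ≈⟨ solve 2 (λ b j → b :+ j :* con false := b) refl (x ^ n) k⁻¹ ⟩
         x ^ n                            ∎)
         (span-* isSubring Pk⁻¹ y∈)
    where open IsSubfield F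

  -- For p = a ∷ as with any a, the coefficients of (p(X) - p(r)) / (X - r).
  quotient : Carrier → List Carrier → List Carrier
  quotient r []       = []
  quotient r (a ∷ as) = ⟦ a ∷ as ⟧ r ∷ quotient r as

  length-quotient : ∀ r as → length (quotient r as) ≡ length as
  length-quotient r []       = ≡.refl
  length-quotient r (a ∷ as) = ≡.cong suc (length-quotient r as)

  -- Adding a constant term `a` to both sides gives p(x) = p(r) + (x - r) q(x) for p = `a ∷ as`.
  division : ∀ r as x → x * ⟦ as ⟧ x ≈ r * ⟦ as ⟧ r + (x + r) * ⟦ quotient r as ⟧ x
  division r []       x =
    solve 2 (λ x r → x :* con false := r :* con false :+ (x :+ r) :* con false) refl x r
  division r (a ∷ as) x = trans (*-congˡ (+-congˡ (division r as x)))
    (solve 5 (λ a x r y z → x :* (a :+ (r :* y :+ (x :+ r) :* z)) :=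
                            r :* (a :+ r :* y) :+ (x :+ r) :* (a :+ r :* y :+ x :* z))
      refl a x r (⟦ as ⟧ r) (⟦ quotient r as ⟧ x))

  root-or-quotient-root : ∀ r {a} as → ⟦ a ∷ as ⟧ r ≈ 0# → ⟦ a ∷ as ⟧ x ≈ 0# →
                          x ≈ r ⊎ ⟦ quotient r as ⟧ x ≈ 0#
  root-or-quotient-root {x} r {a} as er ex with (x + r) ≟ 0#
  ... | yes x+r≈0 = inj₁ (+≈0⇒≈ x+r≈0)
  ... | no  x+r≉0 = inj₂ (*-cancelˡ-0 x+r≉0 (begin
    (x + r) * v
      ≈⟨ solve 3 (λ a u v → v := a :+ u :+ (a :+ (u :+ v))) refl a u _ ⟩
    a + u + (a + (u + (x + r) * v))        ≈⟨ +-congˡ (+-congˡ (division r as x)) ⟨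
    a + u + (a + x * ⟦ as ⟧ x)             ≈⟨ +-cong er ex ⟩
    0# + 0#                                ≈⟨ +-identityˡ 0# ⟩
    0#                                     ∎))
    where
    v = ⟦ quotient r as ⟧ x
    u = r * ⟦ as ⟧ r

  -- The leading coefficient survives: where only zeros follow, evaluation at r returns the
  -- coefficient itself.
  quotient-nonZero : ∀ r → HasNonZero as → HasNonZero (quotient r as)
  quotient-nonZero {a ∷ as} r nz with hasNonZero? as
  ... | yes nz′ = there (quotient-nonZero r nz′)
  ... | no ¬nz′ = here λ e → head-nonZero nz ¬nz′ (trans (sym (⟦⟧-constant as ¬nz′ r)) e)

  -- Splitting of polynomials over a transcendental segment

  record IsNimOrder {r} (_<_ : Carrier → Carrier → Set r) : Set (c ⊔ ℓ ⊔ r) where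
    field
      <-respˡ-≈ : x < z → x ≈ y → y < z
      <-respʳ-≈ : x < y → y ≈ z → x < z
      <-trans   : x < y → y < z → x < z
      compare   : ∀ x y → x < y ⊎ x ≈ y ⊎ y < x
      ≮0        : ¬ x < 0#
      <1⇒≈0     : x < 1# → x ≈ 0#
      +-option  : z < (x + y) →
                  (∃[ x′ ] x′ < x × z ≈ x′ + y) ⊎ (∃[ y′ ] y′ < y × z ≈ x + y′)
      *-option  : z < (x * y) →
                  ∃[ x′ ] ∃[ y′ ] x′ < x × y′ < y × z ≈ x′ * y + x * y′ + x′ * y′

  module NimOrder {r} {_≺_ : Carrier → Carrier → Set r} (nimOrder : IsNimOrder _≺_)
                  (1≉0 : ¬ 1# ≈ 0#) where
    open IsNimOrder nimOrder

    private
      infix 4 _<_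
      _<_ : Carrier → Carrier → Set r
      _<_ = _≺_

    -- Let V be the span of 1, t, …, tⁿ⁻¹ over t.  By induction V is an initial segment of the
    -- ordinals; it omits tⁿ, so V lies below tⁿ.  But the mex formula writes every
    -- ordinal below tⁿ as tⁿ + (t + a₁)⋯(t + aₙ) with aᵢ < t.  So every monic polynomial
    -- agrees at t, and hence everywhere, with a product of this form.
    module TranscendentalSegment {t : Carrier} (F : IsSubfield (_< t))
                                 (t-transcendental : ¬ Integral (_< t) t) where
      open IsSubfield F

      -- The option a tⁿ + t δ + a δ of tⁿ⁺¹ equals tⁿ⁺¹ + (t + a)(tⁿ + δ), so each descent from δ <
      -- tⁿ contributes one linear factor.
      below-power : ∀ n → x < t ^ n → ∃[ f ] length f ≡ n × x ≈ t ^ n + ∏ isSubring f t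
      below-power {x} zero p = [] , ≡.refl , (begin
        x        ≈⟨ <1⇒≈0 p ⟩
        0#       ≈⟨ +-self 1# ⟨
        1# + 1#    ∎)
      below-power {x} (suc n) p with *-option p
      ... | a , δ , a<t , q , e with below-power n q
      ...   | f , l , d = (a , a<t) ∷ f , ≡.cong suc l , (begin
        x                                             ≈⟨ e ⟩
        (a * t ^ n) + (t * δ) + (a * δ)               ≈⟨ +-cong (+-congˡ (*-congˡ d)) (*-congˡ d) ⟩
        (a * t ^ n) + (t * (t ^ n + π)) + (a * (t ^ n + π))
          ≈⟨ solve 4 (λ a t b z → a :* b :+ t :* (b :+ z) :+ a :* (b :+ z) := t :* b :+ (t :+ a) :* z)
               refl a t (t ^ n) π ⟩
        t * t ^ n + (t + a) * π                       ∎)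
        where π = ∏ isSubring f t

      -- Both summands are monic in t of the same degree, so the leading terms cancel.
      power+product-span : ∀ f → Span (_< t) (powers t (length f)) (t ^ length f + ∏ isSubring f t)
      power+product-span []              = nil (+-self 1#)
      power+product-span ((a , a<t) ∷ f) = span-resp
        (solve 4 (λ t b z a → t :* (b :+ z) :+ (a :* (b :+ z) :+ a :* b) := t :* b :+ (t :+ a) :* z)
          refl t b π a)
        (span-+ isSubring (powers-shift isSubring m s)
          (span-+ isSubring (span-there isSubring (span-* isSubring a<t s))
            (cons a<t (span-0 isSubring (powers t m)) (sym (+-identityʳ (a * b))))))
        where
        m = length f
        b = t ^ m
        π = ∏ isSubring f t
        s = power+product-span f

      below-power-span : ∀ n → x < t ^ n → Span (_< t) (powers t n) x
      below-power-span n p with below-power n p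
      ... | f , ≡.refl , e = span-resp (sym e) (power+product-span f)

      -- An ordinal below a tⁿ + w either lowers w, where induction applies, or replaces a tⁿ by an
      -- option a′ tⁿ + (a + a′) ε with a′ < a and ε < tⁿ. In the second case `below-power-span`
      -- writes ε through lower powers.
      span-initial : ∀ n → Span (_< t) (powers t n) y → x < y → Span (_< t) (powers t n) x
      span-initial zero (nil e) p = contradiction (<-respʳ-≈ p e) ≮0
      span-initial {x = x} (suc n) (cons {a} {y = w} a<t s e) p
        with +-option (<-respʳ-≈ p e)
      ... | inj₂ (w′ , q , d) = cons a<t (span-initial n s q) d
      ... | inj₁ (δ , q , d) with *-option q
      ...   | a′ , ε , q₁ , q₂ , d′ = cons a′<t
        (span-+ isSubring (span-* isSubring (+-closed a<t a′<t) (below-power-span n q₂)) s)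
        (begin
          x                                            ≈⟨ d ⟩
          δ + w                                        ≈⟨ +-congʳ d′ ⟩
          (a′ * t ^ n) + (a * ε) + (a′ * ε) + w
            ≈⟨ solve 5 (λ a a′ b e w → a′ :* b :+ a :* e :+ a′ :* e :+ w := a′ :* b :+ ((a :+ a′) :* e :+ w))
                 refl a a′ (t ^ n) ε w ⟩
          (a′ * t ^ n) + ((a + a′) * ε + w)            ∎)
        where
        a′<t : a′ < t
        a′<t = <-trans q₁ a<t

      -- Otherwise tⁿ would itself lie in the span, which is an integral equation for t.
      span<power : ∀ n → Span (_< t) (powers t n) x → x < t ^ n
      span<power {x} n s with compare x (t ^ n)
      ... | inj₁ x<t^n        = x<t^n
      ... | inj₂ (inj₁ x≈t^n) = contradiction (n , span-resp x≈t^n s) t-transcendental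
      ... | inj₂ (inj₂ t^n<x) = contradiction (n , span-initial n s t^n<x) t-transcendental

      -- A nonzero coefficient would make t algebraic over the segment, so all coefficients are
      -- zero.
      vanishing : ∀ {g} → IsPolynomial (_< t) g → g t ≈ 0# → ∀ x → g x ≈ 0#
      vanishing {g} (f , e) gt≈0 x with nonZero? f
      ... | yes nz = contradiction (root⇒integral F f nz (trans (e t) gt≈0)) t-transcendental
      ... | no ¬nz = trans (sym (e x)) (⟦⟧-zero (map proj₁ f) (¬nz ∘ Any.map⁻) x)

      -- Divide f(t) = k tⁿ + y by k. The lower part k⁻¹ y is below tⁿ, hence of the form tⁿ + ∏
      -- h(t), and f agrees with k ∏ h at t. By `vanishing` they agree everywhere.
      splits : (f : List (∃ (_< t))) → NonZero f →
        ∃[ k ] ∃[ h ] k < t × ¬ k ≈ 0# × (∀ x → eval f x ≈ k * ∏ isSubring h x)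
      splits f nz with leading-term isSubring t f nz
      ... | n , k , y , k<t , k≉0 , y∈ , e with inverse k<t k≉0
      ... | k⁻¹ , k⁻¹<t , kk⁻¹≈1 with below-power n (span<power n (span-* isSubring k⁻¹<t y∈))
      ... | h , _ , d = k , h , k<t , k≉0 , λ x → +≈0⇒≈
        (vanishing
          (+-isPolynomial isSubring (f , λ _ → refl)
            (scale-isPolynomial isSubring k<t (∏-isPolynomial isSubring h)))
          (begin
            eval f t + k * π                               ≈⟨ +-congʳ e ⟩
            k * b + y + k * π
              ≈⟨ solve 4 (λ k b y z → k :* b :+ y :+ k :* z := k :* (b :+ z) :+ con true :* y)
                   refl k b y π ⟩
            k * (b + π) + 1# * y                            ≈⟨ +-cong (*-congˡ d) (*-congʳ kk⁻¹≈1) ⟨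
            k * (k⁻¹ * y) + k * k⁻¹ * y
              ≈⟨ solve 3 (λ k j y → k :* (j :* y) :+ k :* j :* y := con false) refl k k⁻¹ y ⟩
            0#                                              ∎)
          x)
        where
        b = t ^ n
        π = ∏ isSubring h t

      root<t : (f : List (∃ (_< t))) → NonZero f → eval f x ≈ 0# → x < t
      root<t {x} f nz e =
        let k , h , _ , k≉0 , d = splits f nz
        in below h (∏-zero isSubring h (*-cancelˡ-0 k≉0 (trans (sym (d x)) e)) 1≉0)
        where
        below : (h : List (∃ (_< t))) → Any (λ (a , _) → x ≈ a) h → x < t
        below ((a , a<t) ∷ _) (here x≈a) = <-respˡ-≈ a<t (sym x≈a)
        below (_ ∷ h)         (there i)  = below h i

      root : ∀ a → a < t → (f : List (∃ (_< t))) → NonZero f →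
             ∃[ x ] x < t × a + x * eval f x ≈ 0#
      root a a<t f nz =
        let _ , h , k<t , _ , d = splits ((a , a<t) ∷ f) (there nz) in root-of h k<t d
        where
        root-of : ∀ {k} h → k < t → (∀ x → a + x * eval f x ≈ k * ∏ isSubring h x) →
                  ∃[ x ] x < t × a + x * eval f x ≈ 0#
        root-of {k} ((r , r<t) ∷ h) _   d = r , r<t , (begin
          a + r * eval f r                 ≈⟨ d r ⟩
          k * ((r + r) * ∏ isSubring h r)
            ≈⟨ solve 3 (λ k r z → k :* ((r :+ r) :* z) := con false) refl k r (∏ isSubring h r) ⟩
          0#                               ∎)
        -- An empty product would make the polynomial constantly k; adding k to its constant term
        -- then gives a polynomial, still nonzero by `nz`, that vanishes at t.
        root-of {k} []              k<t d = contradiction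
          (root⇒integral F ((a + k , +-closed a<t k<t) ∷ f) (there nz) (begin
            a + k + t * eval f t
              ≈⟨ solve 3 (λ a k y → a :+ k :+ y := a :+ y :+ k :* con true)
                   refl a k (t * eval f t) ⟩
            a + t * eval f t + k * 1#    ≈⟨ +-congʳ (d t) ⟩
            k * 1# + k * 1#              ≈⟨ +-self _ ⟩
            0#                           ∎))
          t-transcendental

open import Defs

-- Nim arithmetic: the ordinals form a domain of characteristic 2

module NimArithmetic {ℓ : Level} (em : ExcludedMiddle ℓ) where
  open Classical em

  ≈-setoid : Setoid _ _
  ≈-setoid = record
    { Carrier = Ord ℓ ; _≈_ = _≈_
    ; isEquivalence = record
      { refl  = λ {α} → ≈-refl α
      ; sym   = ≈-sym
      ; trans = ≈-trans } }

  open SetoidReasoning ≈-setoid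

  private
    variable
      α β γ δ α′ β′ γ′ : Ord ℓ

  compare : ∀ α β → α < β ⊎ α ≈ β ⊎ β < α
  compare α β with em {α ≤ β}
  ... | no α≰β = inj₂ (inj₂ (≰⇒> α β α≰β))
  ... | yes α≤β with <⊎≈ α≤β
  ...   | inj₁ α<β = inj₁ α<β
  ...   | inj₂ α≈β = inj₂ (inj₁ α≈β)

  ≮⇒≈ : ¬ α < β → ¬ β < α → α ≈ β
  ≮⇒≈ {α} {β} α≮β β≮α with compare α β
  ... | inj₁ α<β        = contradiction α<β α≮β
  ... | inj₂ (inj₁ α≈β) = α≈β
  ... | inj₂ (inj₂ β<α) = contradiction β<α β≮α

  <-respʳ-≈ : α < β → β ≈ γ → α < γ
  <-respʳ-≈ α<β (β≤γ , _) = <-≤-trans _ _ _ α<β β≤γ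

  <-respˡ-≈ : α < γ → α ≈ β → β < γ
  <-respˡ-≈ α<γ (_ , β≤α) = ≤-<-trans _ _ _ β≤α α<γ

  <⇒≉ : α < β → ¬ α ≈ β
  <⇒≉ {α} α<β α≈β = <-irrefl α (<-respʳ-≈ α<β (≈-sym α≈β))

  ≮𝟘 : ¬ α < 𝟘
  ≮𝟘 (() , _)

  <𝟙⇒≈𝟘 : α < 𝟙 → α ≈ 𝟘
  <𝟙⇒≈𝟘 (_ , α≤𝟘) = α≤𝟘 , λ ()

  𝟘<𝟙 : 𝟘 {ℓ} < 𝟙
  𝟘<𝟙 = _ , ≤-refl 𝟘

  ⊕-congˡ : β ≈ γ → α ⊕ β ≈ α ⊕ γ
  ⊕-congˡ = ⊕-cong (≈-refl _)

  ⊕-congʳ : α ≈ β → α ⊕ γ ≈ β ⊕ γ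
  ⊕-congʳ e = ⊕-cong e (≈-refl _)

  ⊗-congˡ : β ≈ γ → α ⊗ β ≈ α ⊗ γ
  ⊗-congˡ = ⊗-cong (≈-refl _)

  ⊗-congʳ : α ≈ β → α ⊗ γ ≈ β ⊗ γ
  ⊗-congʳ e = ⊗-cong e (≈-refl _)

  -- If α < β, then α ⊕ γ is an option of β ⊕ γ and so differs from it.
  ⊕-cancelʳ : ∀ γ → α ⊕ γ ≈ β ⊕ γ → α ≈ β
  ⊕-cancelʳ {α} {β} γ e = ≮⇒≈
    (λ α<β → proj₁ (⊕-isMex β γ) (inj₁ (α , α<β , ≈-sym e)))
    (λ β<α → proj₁ (⊕-isMex α γ) (inj₁ (β , β<α , e)))

  ⊕-cancelˡ : ∀ γ → γ ⊕ α ≈ γ ⊕ β → α ≈ β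
  ⊕-cancelˡ {α} {β} γ e = ≮⇒≈
    (λ α<β → proj₁ (⊕-isMex γ β) (inj₂ (α , α<β , ≈-sym e)))
    (λ β<α → proj₁ (⊕-isMex γ α) (inj₂ (β , β<α , e)))

  -- Each identity x ≈ y below is proved by refuting x < y and y < x: a smaller
  -- value is an option of the mex, and the induction hypothesis turns that
  -- option into one excluded by cancellation.

  ⊕-comm : ∀ α β → α ⊕ β ≈ β ⊕ α
  ⊕-comm α β = go α β (<-wellFounded α) (<-wellFounded β)
    where
    go : ∀ α β → Acc _<_ α → Acc _<_ β → α ⊕ β ≈ β ⊕ α
    go α β (acc r) (acc s) = ≮⇒≈ lt gt
      where
      lt : ¬ α ⊕ β < β ⊕ α
      lt p with proj₂ (⊕-isMex β α) _ p
      ... | inj₁ (β′ , q , e) = <⇒≉ q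
        (⊕-cancelˡ α (≈-trans (go α β′ (acc r) (s q)) (≈-sym e)))
      ... | inj₂ (α′ , q , e) = <⇒≉ q
        (⊕-cancelʳ β (≈-trans (go α′ β (r q) (acc s)) (≈-sym e)))
      gt : ¬ β ⊕ α < α ⊕ β
      gt p with proj₂ (⊕-isMex α β) _ p
      ... | inj₁ (α′ , q , e) = <⇒≉ q
        (⊕-cancelˡ β (≈-trans (≈-sym (go α′ β (r q) (acc s))) (≈-sym e)))
      ... | inj₂ (β′ , q , e) = <⇒≉ q
        (⊕-cancelʳ α (≈-trans (≈-sym (go α β′ (acc r) (s q))) (≈-sym e)))

  ⊕-assoc : ∀ α β γ → α ⊕ β ⊕ γ ≈ α ⊕ (β ⊕ γ)
  ⊕-assoc α β γ = go α β γ (<-wellFounded α) (<-wellFounded β) (<-wellFounded γ)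
    where
    go : ∀ α β γ → Acc _<_ α → Acc _<_ β → Acc _<_ γ → α ⊕ β ⊕ γ ≈ α ⊕ (β ⊕ γ)
    go α β γ (acc r) (acc s) (acc t) = ≮⇒≈ lt gt
      where
      ihα : α′ < α → α′ ⊕ β ⊕ γ ≈ α′ ⊕ (β ⊕ γ)
      ihα q = go _ β γ (r q) (acc s) (acc t)
      ihβ : β′ < β → α ⊕ β′ ⊕ γ ≈ α ⊕ (β′ ⊕ γ)
      ihβ q = go α _ γ (acc r) (s q) (acc t)
      ihγ : γ′ < γ → α ⊕ β ⊕ γ′ ≈ α ⊕ (β ⊕ γ′)
      ihγ q = go α β _ (acc r) (acc s) (t q)
      lt : ¬ α ⊕ β ⊕ γ < α ⊕ (β ⊕ γ)
      lt p with proj₂ (⊕-isMex α (β ⊕ γ)) _ p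
      ... | inj₁ (α′ , q , e) = <⇒≉ q
        (⊕-cancelʳ β (⊕-cancelʳ γ (≈-trans (ihα q) (≈-sym e))))
      ... | inj₂ (δ , q , e) with proj₂ (⊕-isMex β γ) _ q
      ...   | inj₁ (β′ , q′ , d) = <⇒≉ q′
        (⊕-cancelˡ α (⊕-cancelʳ γ (≈-trans (ihβ q′) (≈-sym (≈-trans e (⊕-congˡ d))))))
      ...   | inj₂ (γ′ , q′ , d) = <⇒≉ q′
        (⊕-cancelˡ (α ⊕ β) (≈-trans (ihγ q′) (≈-sym (≈-trans e (⊕-congˡ d)))))
      gt : ¬ α ⊕ (β ⊕ γ) < α ⊕ β ⊕ γ
      gt p with proj₂ (⊕-isMex (α ⊕ β) γ) _ p
      ... | inj₂ (γ′ , q , e) = <⇒≉ q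
        (⊕-cancelˡ β (⊕-cancelˡ α (≈-trans (≈-sym (ihγ q)) (≈-sym e))))
      ... | inj₁ (δ , q , e) with proj₂ (⊕-isMex α β) _ q
      ...   | inj₁ (α′ , q′ , d) = <⇒≉ q′
        (⊕-cancelʳ (β ⊕ γ) (≈-trans (≈-sym (ihα q′)) (≈-sym (≈-trans e (⊕-congʳ d)))))
      ...   | inj₂ (β′ , q′ , d) = <⇒≉ q′
        (⊕-cancelʳ γ (⊕-cancelˡ α (≈-trans (≈-sym (ihβ q′)) (≈-sym (≈-trans e (⊕-congʳ d))))))

  ⊕-identityʳ : ∀ α → α ⊕ 𝟘 ≈ α
  ⊕-identityʳ α = go α (<-wellFounded α)
    where
    go : ∀ α → Acc _<_ α → α ⊕ 𝟘 ≈ α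
    go α (acc r) = ≮⇒≈ lt gt
      where
      lt : ¬ α ⊕ 𝟘 < α
      lt p = <⇒≉ p (⊕-cancelʳ 𝟘 (go (α ⊕ 𝟘) (r p)))
      gt : ¬ α < α ⊕ 𝟘
      gt p with proj₂ (⊕-isMex α 𝟘) _ p
      ... | inj₁ (α′ , q , e) = <⇒≉ q (≈-sym (≈-trans e (go α′ (r q))))
      ... | inj₂ (_ , q , _)  = ≮𝟘 q

  ⊕-self : ∀ α → α ⊕ α ≈ 𝟘
  ⊕-self α = go α (<-wellFounded α)
    where
    go : ∀ α → Acc _<_ α → α ⊕ α ≈ 𝟘
    go α (acc r) = ≮⇒≈ ≮𝟘 gt
      where
      gt : ¬ 𝟘 < α ⊕ α
      gt p with proj₂ (⊕-isMex α α) _ p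
      ... | inj₁ (α′ , q , e) = <⇒≉ q (⊕-cancelˡ α′ (≈-trans (go α′ (r q)) e))
      ... | inj₂ (α′ , q , e) = <⇒≉ q (⊕-cancelʳ α′ (≈-trans (go α′ (r q)) e))

  ⊕-abelianGroup : AbelianGroup _ _
  ⊕-abelianGroup = record
    { Carrier = Ord ℓ ; _≈_ = _≈_ ; _∙_ = _⊕_ ; ε = 𝟘 ; _⁻¹ = id
    ; isAbelianGroup = record
      { isGroup = record
        { isMonoid = record
          { isSemigroup = record
            { isMagma = record
              { isEquivalence = Setoid.isEquivalence ≈-setoid
              ; ∙-cong = ⊕-cong }
            ; assoc = ⊕-assoc }
          ; identity = (λ α → ≈-trans (⊕-comm 𝟘 α) (⊕-identityʳ α)) , ⊕-identityʳ }
        ; inverse = ⊕-self , ⊕-self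
        ; ⁻¹-cong = id }
      ; comm = ⊕-comm } }

  open BooleanGroupSolver ⊕-abelianGroup ⊕-self

  ⊗-option : (α β α′ β′ : Ord ℓ) → Ord ℓ
  ⊗-option α β α′ β′ = (α′ ⊗ β) ⊕ (α ⊗ β′) ⊕ (α′ ⊗ β′)

  -- ⊗-option α β α′ β′ ⊕ α ⊗ β is (α ⊕ α′) ⊗ (β ⊕ β′) in disguise, hence
  -- symmetric in α, α′ and in β, β′; this reduces to the case α′ < α, β′ < β.
  ⊗-option-excluded : ∀ α β α′ β′ → ¬ α′ ≈ α → ¬ β′ ≈ β →
                      ¬ α ⊗ β ≈ ⊗-option α β α′ β′
  ⊗-option-excluded α β α′ β′ α′≉α β′≉β e with compare α′ α | compare β′ β
  ... | inj₂ (inj₁ α′≈α) | _ = α′≉α α′≈α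
  ... | inj₁ _           | inj₂ (inj₁ β′≈β) = β′≉β β′≈β
  ... | inj₂ (inj₂ _)    | inj₂ (inj₁ β′≈β) = β′≉β β′≈β
  ... | inj₁ p           | inj₁ q = proj₁ (⊗-isMex α β) (α′ , β′ , p , q , e)
  ... | inj₁ p           | inj₂ (inj₂ q) = proj₁ (⊗-isMex α β′) (α′ , β , p , q , (begin
    b
      ≈⟨ solve (a ∷ b ∷ c ∷ d ∷ []) (var 1F) (var 2F :+ var 3F :+ (var 2F :+ var 1F :+ var 3F))
           ≡.refl ⟩
    c ⊕ d ⊕ (c ⊕ b ⊕ d)  ≈⟨ ⊕-congˡ e ⟨
    c ⊕ d ⊕ a
      ≈⟨ solve (a ∷ b ∷ c ∷ d ∷ []) (var 2F :+ var 3F :+ var 0F) (var 3F :+ var 0F :+ var 2F)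
           ≡.refl ⟩
    d ⊕ a ⊕ c      ∎))
    where
    a = α ⊗ β
    b = α ⊗ β′
    c = α′ ⊗ β
    d = α′ ⊗ β′
  ... | inj₂ (inj₂ p)    | inj₁ q = proj₁ (⊗-isMex α′ β) (α , β′ , p , q , (begin
    c
      ≈⟨ solve (a ∷ b ∷ c ∷ d ∷ []) (var 2F) (var 1F :+ var 3F :+ (var 2F :+ var 1F :+ var 3F))
           ≡.refl ⟩
    b ⊕ d ⊕ (c ⊕ b ⊕ d)  ≈⟨ ⊕-congˡ e ⟨
    b ⊕ d ⊕ a
      ≈⟨ solve (a ∷ b ∷ c ∷ d ∷ []) (var 1F :+ var 3F :+ var 0F) (var 0F :+ var 3F :+ var 1F)
           ≡.refl ⟩
    a ⊕ d ⊕ b      ∎))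
    where
    a = α ⊗ β
    b = α ⊗ β′
    c = α′ ⊗ β
    d = α′ ⊗ β′
  ... | inj₂ (inj₂ p)    | inj₂ (inj₂ q) = proj₁ (⊗-isMex α′ β′) (α , β , p , q , (begin
    d
      ≈⟨ solve (a ∷ b ∷ c ∷ d ∷ []) (var 3F) (var 1F :+ var 2F :+ (var 2F :+ var 1F :+ var 3F))
           ≡.refl ⟩
    b ⊕ c ⊕ (c ⊕ b ⊕ d)  ≈⟨ ⊕-congˡ e ⟨
    b ⊕ c ⊕ a      ∎))
    where
    a = α ⊗ β
    b = α ⊗ β′
    c = α′ ⊗ β
    d = α′ ⊗ β′

  ⊗-comm : ∀ α β → α ⊗ β ≈ β ⊗ α
  ⊗-comm α β = go α β (<-wellFounded α) (<-wellFounded β)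
    where
    go : ∀ α β → Acc _<_ α → Acc _<_ β → α ⊗ β ≈ β ⊗ α
    go α β (acc r) (acc s) = ≮⇒≈ lt gt
      where
      swap : α′ < α → β′ < β → ⊗-option α β α′ β′ ≈ ⊗-option β α β′ α′
      swap {α′} {β′} p q = begin
        (α′ ⊗ β) ⊕ (α ⊗ β′) ⊕ (α′ ⊗ β′)
          ≈⟨ ⊕-cong (⊕-comm _ _) (go α′ β′ (r p) (s q)) ⟩
        (α ⊗ β′) ⊕ (α′ ⊗ β) ⊕ (β′ ⊗ α′)
          ≈⟨ ⊕-congʳ (⊕-cong (go α β′ (acc r) (s q)) (go α′ β (r p) (acc s))) ⟩
        (β′ ⊗ α) ⊕ (β ⊗ α′) ⊕ (β′ ⊗ α′) ∎
      lt : ¬ α ⊗ β < β ⊗ α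
      lt p with proj₂ (⊗-isMex β α) _ p
      ... | β′ , α′ , q , q′ , e =
        proj₁ (⊗-isMex α β) (α′ , β′ , q′ , q , ≈-trans e (≈-sym (swap q′ q)))
      gt : ¬ β ⊗ α < α ⊗ β
      gt p with proj₂ (⊗-isMex α β) _ p
      ... | α′ , β′ , q , q′ , e =
        proj₁ (⊗-isMex β α) (β′ , α′ , q′ , q , ≈-trans e (swap q q′))

  ⊗-zeroʳ : ∀ α → α ⊗ 𝟘 ≈ 𝟘
  ⊗-zeroʳ α = ≮⇒≈ ≮𝟘 λ p → ≮𝟘 (proj₁ (proj₂ (proj₂ (proj₂ (proj₂ (⊗-isMex α 𝟘) _ p)))))

  ⊗-option-𝟘 : ∀ α β α′ → ⊗-option α β α′ 𝟘 ≈ α′ ⊗ β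
  ⊗-option-𝟘 α β α′ = begin
    (α′ ⊗ β) ⊕ (α ⊗ 𝟘) ⊕ (α′ ⊗ 𝟘)  ≈⟨ ⊕-cong (⊕-congˡ (⊗-zeroʳ α)) (⊗-zeroʳ α′) ⟩
    (α′ ⊗ β) ⊕ 𝟘 ⊕ 𝟘               ≈⟨ ⊕-identityʳ _ ⟩
    (α′ ⊗ β) ⊕ 𝟘                   ≈⟨ ⊕-identityʳ _ ⟩
    α′ ⊗ β                         ∎

  ⊗-option-cong : α ≈ α′ → β ≈ β′ → ∀ γ δ → ⊗-option γ δ α β ≈ ⊗-option γ δ α′ β′
  ⊗-option-cong e d γ δ = ⊕-cong (⊕-cong (⊗-congʳ e) (⊗-congˡ d)) (⊗-cong e d)

  ⊗-identityʳ : ∀ α → α ⊗ 𝟙 ≈ α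
  ⊗-identityʳ α = go α (<-wellFounded α)
    where
    go : ∀ α → Acc _<_ α → α ⊗ 𝟙 ≈ α
    go α (acc r) = ≮⇒≈ lt gt
      where
      lt : ¬ α ⊗ 𝟙 < α
      -- If α ⊗ 𝟙 were below α, the induction hypothesis would make it one of its own options, with
      -- α′ = α ⊗ 𝟙 and β′ = 𝟘.
      lt p = proj₁ (⊗-isMex α 𝟙) (α ⊗ 𝟙 , 𝟘 , p , 𝟘<𝟙 , (begin
        α ⊗ 𝟙                      ≈⟨ go (α ⊗ 𝟙) (r p) ⟨
        (α ⊗ 𝟙) ⊗ 𝟙                ≈⟨ ⊗-option-𝟘 α 𝟙 (α ⊗ 𝟙) ⟨
        ⊗-option α 𝟙 (α ⊗ 𝟙) 𝟘     ∎))
      gt : ¬ α < α ⊗ 𝟙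
      gt p with proj₂ (⊗-isMex α 𝟙) _ p
      ... | α′ , β′ , q , q′ , e = <⇒≉ q (≈-sym (begin
        α                    ≈⟨ e ⟩
        ⊗-option α 𝟙 α′ β′   ≈⟨ ⊗-option-cong (≈-refl α′) (<𝟙⇒≈𝟘 q′) α 𝟙 ⟩
        ⊗-option α 𝟙 α′ 𝟘    ≈⟨ ⊗-option-𝟘 α 𝟙 α′ ⟩
        α′ ⊗ 𝟙               ≈⟨ go α′ (r q) ⟩
        α′                   ∎))

  ⊗-distribʳ-⊕ : ∀ γ α β → (α ⊕ β) ⊗ γ ≈ (α ⊗ γ) ⊕ (β ⊗ γ)
  ⊗-distribʳ-⊕ γ α β = go α β γ (<-wellFounded α) (<-wellFounded β) (<-wellFounded γ)
    where
    go : ∀ α β γ → Acc _<_ α → Acc _<_ β → Acc _<_ γ →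
         (α ⊕ β) ⊗ γ ≈ (α ⊗ γ) ⊕ (β ⊗ γ)
    go α β γ (acc r) (acc s) (acc t) = ≮⇒≈ lt gt
      where
      optionˡ : α′ < α → γ′ < γ →
        ⊗-option (α ⊕ β) γ (α′ ⊕ β) γ′ ≈ ⊗-option α γ α′ γ′ ⊕ (β ⊗ γ)
      optionˡ {α′} {γ′} p q = begin
        ((α′ ⊕ β) ⊗ γ) ⊕ ((α ⊕ β) ⊗ γ′) ⊕ ((α′ ⊕ β) ⊗ γ′)
          ≈⟨ ⊕-cong (⊕-cong (go α′ β γ (r p) (acc s) (acc t)) (go α β γ′ (acc r) (acc s) (t q)))
                    (go α′ β γ′ (r p) (acc s) (t q)) ⟩
        ((α′ ⊗ γ) ⊕ (β ⊗ γ)) ⊕ ((α ⊗ γ′) ⊕ (β ⊗ γ′)) ⊕ ((α′ ⊗ γ′) ⊕ (β ⊗ γ′))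
          ≈⟨ solve (α′ ⊗ γ ∷ β ⊗ γ ∷ α ⊗ γ′ ∷ β ⊗ γ′ ∷ α′ ⊗ γ′ ∷ [])
                   ((var 0F :+ var 1F) :+ (var 2F :+ var 3F) :+ (var 4F :+ var 3F))
                   (var 0F :+ var 2F :+ var 4F :+ var 1F) ≡.refl ⟩
        ⊗-option α γ α′ γ′ ⊕ (β ⊗ γ) ∎
      optionʳ : β′ < β → γ′ < γ →
        ⊗-option (α ⊕ β) γ (α ⊕ β′) γ′ ≈ (α ⊗ γ) ⊕ ⊗-option β γ β′ γ′
      optionʳ {β′} {γ′} p q = begin
        ((α ⊕ β′) ⊗ γ) ⊕ ((α ⊕ β) ⊗ γ′) ⊕ ((α ⊕ β′) ⊗ γ′)
          ≈⟨ ⊕-cong (⊕-cong (go α β′ γ (acc r) (s p) (acc t)) (go α β γ′ (acc r) (acc s) (t q)))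
                    (go α β′ γ′ (acc r) (s p) (t q)) ⟩
        ((α ⊗ γ) ⊕ (β′ ⊗ γ)) ⊕ ((α ⊗ γ′) ⊕ (β ⊗ γ′)) ⊕ ((α ⊗ γ′) ⊕ (β′ ⊗ γ′))
          ≈⟨ solve (α ⊗ γ ∷ β′ ⊗ γ ∷ α ⊗ γ′ ∷ β ⊗ γ′ ∷ β′ ⊗ γ′ ∷ [])
                   ((var 0F :+ var 1F) :+ (var 2F :+ var 3F) :+ (var 2F :+ var 4F))
                   (var 0F :+ (var 1F :+ var 3F :+ var 4F)) ≡.refl ⟩
        (α ⊗ γ) ⊕ ⊗-option β γ β′ γ′ ∎
      lt : ¬ (α ⊕ β) ⊗ γ < (α ⊗ γ) ⊕ (β ⊗ γ)
      lt p with proj₂ (⊕-isMex (α ⊗ γ) (β ⊗ γ)) _ p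
      lt p | inj₁ (δ , q , e) with proj₂ (⊗-isMex α γ) _ q
      -- α′ ⊕ β need not be smaller than α ⊕ β, only different, so the mex property alone does not
      -- exclude this option.
      ... | α′ , γ′ , q₁ , q₂ , d = ⊗-option-excluded (α ⊕ β) γ (α′ ⊕ β) γ′
        (<⇒≉ q₁ ∘ ⊕-cancelʳ β) (<⇒≉ q₂)
        (≈-trans e (≈-trans (⊕-congʳ d) (≈-sym (optionˡ q₁ q₂))))
      lt p | inj₂ (δ , q , e) with proj₂ (⊗-isMex β γ) _ q
      ... | β′ , γ′ , q₁ , q₂ , d = ⊗-option-excluded (α ⊕ β) γ (α ⊕ β′) γ′
        (<⇒≉ q₁ ∘ ⊕-cancelˡ α) (<⇒≉ q₂)
        (≈-trans e (≈-trans (⊕-congˡ d) (≈-sym (optionʳ q₁ q₂))))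
      gt : ¬ (α ⊗ γ) ⊕ (β ⊗ γ) < (α ⊕ β) ⊗ γ
      gt p with proj₂ (⊗-isMex (α ⊕ β) γ) _ p
      ... | δ , γ′ , q , q₂ , e with proj₂ (⊕-isMex α β) _ q
      ...   | inj₁ (α′ , q₁ , d) = proj₁ (⊗-isMex α γ) (α′ , γ′ , q₁ , q₂ ,
        ⊕-cancelʳ (β ⊗ γ)
          (≈-trans e (≈-trans (⊗-option-cong d (≈-refl γ′) _ _) (optionˡ q₁ q₂))))
      ...   | inj₂ (β′ , q₁ , d) = proj₁ (⊗-isMex β γ) (β′ , γ′ , q₁ , q₂ ,
        ⊕-cancelˡ (α ⊗ γ)
          (≈-trans e (≈-trans (⊗-option-cong d (≈-refl γ′) _ _) (optionʳ q₁ q₂))))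

  ⊗-distribˡ-⊕ : ∀ γ α β → γ ⊗ (α ⊕ β) ≈ (γ ⊗ α) ⊕ (γ ⊗ β)
  ⊗-distribˡ-⊕ γ α β = begin
    γ ⊗ (α ⊕ β)        ≈⟨ ⊗-comm γ (α ⊕ β) ⟩
    (α ⊕ β) ⊗ γ        ≈⟨ ⊗-distribʳ-⊕ γ α β ⟩
    (α ⊗ γ) ⊕ (β ⊗ γ)  ≈⟨ ⊕-cong (⊗-comm α γ) (⊗-comm β γ) ⟩
    (γ ⊗ α) ⊕ (γ ⊗ β)  ∎

  ⊗-assoc : ∀ α β γ → α ⊗ β ⊗ γ ≈ α ⊗ (β ⊗ γ)
  ⊗-assoc α β γ = go α β γ (<-wellFounded α) (<-wellFounded β) (<-wellFounded γ)
    where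
    ⊗-distribʳ³ : ∀ δ α β γ → (α ⊕ β ⊕ γ) ⊗ δ ≈ (α ⊗ δ) ⊕ (β ⊗ δ) ⊕ (γ ⊗ δ)
    ⊗-distribʳ³ δ α β γ = ≈-trans (⊗-distribʳ-⊕ δ _ _) (⊕-congʳ (⊗-distribʳ-⊕ δ α β))

    ⊗-distribˡ³ : ∀ δ α β γ → δ ⊗ (α ⊕ β ⊕ γ) ≈ (δ ⊗ α) ⊕ (δ ⊗ β) ⊕ (δ ⊗ γ)
    ⊗-distribˡ³ δ α β γ = ≈-trans (⊗-distribˡ-⊕ δ _ _) (⊕-congʳ (⊗-distribˡ-⊕ δ α β))

    go : ∀ α β γ → Acc _<_ α → Acc _<_ β → Acc _<_ γ → α ⊗ β ⊗ γ ≈ α ⊗ (β ⊗ γ)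
    go α β γ (acc r) (acc s) (acc t) = ≮⇒≈ lt gt
      where
      -- Both sides expand into the same seven triple products, each with at least one primed
      -- factor, so induction reassociates every one.
      option : α′ < α → β′ < β → γ′ < γ →
        ⊗-option (α ⊗ β) γ (⊗-option α β α′ β′) γ′ ≈
        ⊗-option α (β ⊗ γ) α′ (⊗-option β γ β′ γ′)
      option {α′} {β′} {γ′} p q q′ = begin
        ⊗-option (α ⊗ β) γ (⊗-option α β α′ β′) γ′
          ≈⟨ ⊕-cong (⊕-congʳ (⊗-distribʳ³ γ _ _ _)) (⊗-distribʳ³ γ′ _ _ _) ⟩
        (α′ ⊗ β ⊗ γ) ⊕ (α ⊗ β′ ⊗ γ) ⊕ (α′ ⊗ β′ ⊗ γ) ⊕ (α ⊗ β ⊗ γ′) ⊕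
        ((α′ ⊗ β ⊗ γ′) ⊕ (α ⊗ β′ ⊗ γ′) ⊕ (α′ ⊗ β′ ⊗ γ′))
          ≈⟨ ⊕-cong
               (⊕-cong (⊕-cong (⊕-cong (go α′ β γ (r p) (acc s) (acc t))
                                       (go α β′ γ (acc r) (s q) (acc t)))
                               (go α′ β′ γ (r p) (s q) (acc t)))
                       (go α β γ′ (acc r) (acc s) (t q′)))
               (⊕-cong (⊕-cong (go α′ β γ′ (r p) (acc s) (t q′))
                               (go α β′ γ′ (acc r) (s q) (t q′)))
                       (go α′ β′ γ′ (r p) (s q) (t q′))) ⟩
        (α′ ⊗ (β ⊗ γ)) ⊕ (α ⊗ (β′ ⊗ γ)) ⊕ (α′ ⊗ (β′ ⊗ γ)) ⊕ (α ⊗ (β ⊗ γ′)) ⊕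
        ((α′ ⊗ (β ⊗ γ′)) ⊕ (α ⊗ (β′ ⊗ γ′)) ⊕ (α′ ⊗ (β′ ⊗ γ′)))
          ≈⟨ solve (α′ ⊗ (β ⊗ γ) ∷ α ⊗ (β′ ⊗ γ) ∷ α′ ⊗ (β′ ⊗ γ) ∷ α ⊗ (β ⊗ γ′) ∷
                    α′ ⊗ (β ⊗ γ′) ∷ α ⊗ (β′ ⊗ γ′) ∷ α′ ⊗ (β′ ⊗ γ′) ∷ [])
               (var 0F :+ var 1F :+ var 2F :+ var 3F :+ (var 4F :+ var 5F :+ var 6F))
               (var 0F :+ (var 1F :+ var 3F :+ var 5F) :+ (var 2F :+ var 4F :+ var 6F)) ≡.refl ⟩
        (α′ ⊗ (β ⊗ γ)) ⊕ ((α ⊗ (β′ ⊗ γ)) ⊕ (α ⊗ (β ⊗ γ′)) ⊕ (α ⊗ (β′ ⊗ γ′))) ⊕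
        ((α′ ⊗ (β′ ⊗ γ)) ⊕ (α′ ⊗ (β ⊗ γ′)) ⊕ (α′ ⊗ (β′ ⊗ γ′)))
          ≈⟨ ⊕-cong (⊕-congˡ (⊗-distribˡ³ α _ _ _)) (⊗-distribˡ³ α′ _ _ _) ⟨
        ⊗-option α (β ⊗ γ) α′ (⊗-option β γ β′ γ′) ∎
      lt : ¬ α ⊗ β ⊗ γ < α ⊗ (β ⊗ γ)
      lt p with proj₂ (⊗-isMex α (β ⊗ γ)) _ p
      ... | α′ , δ , q , q′ , e with proj₂ (⊗-isMex β γ) _ q′
      ...   | β′ , γ′ , q₁ , q₂ , d = ⊗-option-excluded (α ⊗ β) γ (⊗-option α β α′ β′) γ′
        (⊗-option-excluded α β α′ β′ (<⇒≉ q) (<⇒≉ q₁) ∘ ≈-sym) (<⇒≉ q₂)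
        (≈-trans e (≈-trans (⊗-option-cong (≈-refl α′) d _ _) (≈-sym (option q q₁ q₂))))
      gt : ¬ α ⊗ (β ⊗ γ) < α ⊗ β ⊗ γ
      gt p with proj₂ (⊗-isMex (α ⊗ β) γ) _ p
      ... | δ , γ′ , q , q′ , e with proj₂ (⊗-isMex α β) _ q
      ...   | α′ , β′ , q₁ , q₂ , d = ⊗-option-excluded α (β ⊗ γ) α′ (⊗-option β γ β′ γ′)
        (<⇒≉ q₁) (⊗-option-excluded β γ β′ γ′ (<⇒≉ q₂) (<⇒≉ q′) ∘ ≈-sym)
        (≈-trans e (≈-trans (⊗-option-cong d (≈-refl γ′) _ _) (option q₁ q₂ q′)))

  ≉𝟘⇒𝟘< : ¬ α ≈ 𝟘 → 𝟘 < α
  ≉𝟘⇒𝟘< {α} α≉𝟘 with compare α 𝟘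
  ... | inj₁ α<𝟘        = contradiction α<𝟘 ≮𝟘
  ... | inj₂ (inj₁ α≈𝟘) = contradiction α≈𝟘 α≉𝟘
  ... | inj₂ (inj₂ 𝟘<α) = 𝟘<α

  -- For positive factors 𝟘 is an option of the product, the one with both smaller ordinals 𝟘.
  ⊗-nonzero : ¬ α ≈ 𝟘 → ¬ β ≈ 𝟘 → ¬ α ⊗ β ≈ 𝟘
  ⊗-nonzero {α} {β} α≉𝟘 β≉𝟘 e = proj₁ (⊗-isMex α β)
    (𝟘 , 𝟘 , ≉𝟘⇒𝟘< α≉𝟘 , ≉𝟘⇒𝟘< β≉𝟘 , (begin
      α ⊗ β             ≈⟨ e ⟩
      𝟘                 ≈⟨ ⊗-zeroʳ β ⟨
      β ⊗ 𝟘             ≈⟨ ⊗-comm β 𝟘 ⟩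
      𝟘 ⊗ β             ≈⟨ ⊗-option-𝟘 α β 𝟘 ⟨
      ⊗-option α β 𝟘 𝟘  ∎))

  On₂-isCommutativeRing : IsCommutativeRing _≈_ _⊕_ _⊗_ id 𝟘 𝟙
  On₂-isCommutativeRing = record
    { isRing = record
      { +-isAbelianGroup = AbelianGroup.isAbelianGroup ⊕-abelianGroup
      ; *-cong     = ⊗-cong
      ; *-assoc    = ⊗-assoc
      ; *-identity = (λ α → ≈-trans (⊗-comm 𝟙 α) (⊗-identityʳ α)) , ⊗-identityʳ
      ; distrib    = ⊗-distribˡ-⊕ , ⊗-distribʳ-⊕ }
    ; *-comm = ⊗-comm }

  On₂-commutativeRing : CommutativeRing _ _
  On₂-commutativeRing = record { isCommutativeRing = On₂-isCommutativeRing }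

lowerExcludedMiddle : ∀ {ℓ} → ExcludedMiddle (Level.suc ℓ) → ExcludedMiddle ℓ
lowerExcludedMiddle {ℓ} em {P} = map′ lower lift (em {Lift (Level.suc ℓ) P})

-- Field ordinals and the least transcendental

module FieldOrdinals {ℓ : Level} (em⁺ : ExcludedMiddle (Level.suc ℓ)) where

  private
    em : ExcludedMiddle ℓ
    em = lowerExcludedMiddle em⁺

  open Classical em
  open NimArithmetic em

  open DomainOfCharacteristicTwo On₂-commutativeRing ⊕-self (λ _ _ → em) ⊗-nonzero
  open OverSubfield
  open Polynomial (On₂ ℓ) using (⟦_⟧)

  private
    variable
      α β γ t u : Ord ℓ

  𝟙≉𝟘 : ¬ 𝟙 {ℓ} ≈ 𝟘
  𝟙≉𝟘 = <⇒≉ 𝟘<𝟙 ∘ ≈-sym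

  fieldOrdinal⇒subfield : IsFieldOrdinal u → IsSubfield (_< u)
  fieldOrdinal⇒subfield F = record
    { isSubring = record
      { resp     = λ e p → <-respˡ-≈ p e
      ; 1∈       = 𝟙<u
      ; +-closed = ⊕-closed
      ; *-closed = ⊗-closed
      }
    ; inverse = λ {α} p α≉𝟘 →
        let (β , q) , e = IsField.inverse isField (α , p) α≉𝟘 in β , q , e
    }
    where open IsFieldOrdinal F

  subfield⇒fieldOrdinal : IsSubfield (_< u) → IsFieldOrdinal u
  subfield⇒fieldOrdinal F = record
    { 𝟘<u      = 0∈
    ; 𝟙<u      = 1∈
    ; ⊕-closed = +-closed
    ; ⊗-closed = *-closed
    ; isField  = record
      { isCommutativeRing = record
        { isRing = record
          { +-isAbelianGroup = record
            { isGroup = record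
              { isMonoid = record
                { isSemigroup = record
                  { isMagma = record
                    { isEquivalence = record
                      { refl = λ {x} → ≈-refl (proj₁ x) ; sym = ≈-sym ; trans = ≈-trans }
                    ; ∙-cong = ⊕-cong }
                  ; assoc = λ _ _ _ → ⊕-assoc _ _ _ }
                ; identity = (λ _ → On₂.+-identityˡ _) , (λ _ → On₂.+-identityʳ _) }
              ; inverse = (λ _ → ⊕-self _) , (λ _ → ⊕-self _)
              ; ⁻¹-cong = id }
            ; comm = λ _ _ → ⊕-comm _ _ }
          ; *-cong     = ⊗-cong
          ; *-assoc    = λ _ _ _ → ⊗-assoc _ _ _
          ; *-identity = (λ _ → On₂.*-identityˡ _) , (λ _ → On₂.*-identityʳ _)
          ; distrib    = (λ _ _ _ → ⊗-distribˡ-⊕ _ _ _) , (λ _ _ _ → ⊗-distribʳ-⊕ _ _ _) }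
        ; *-comm = λ _ _ → ⊗-comm _ _ }
      ; 0≉1     = 𝟙≉𝟘 ∘ ≈-sym
      ; inverse = λ (α , p) α≉𝟘 → let β , q , e = inverse p α≉𝟘 in (β , q) , e
      }
    }
    where
    open IsSubfield F
    module On₂ = IsCommutativeRing On₂-isCommutativeRing

  nimOrder : IsNimOrder _<_
  nimOrder = record
    { <-respˡ-≈ = <-respˡ-≈
    ; <-respʳ-≈ = <-respʳ-≈
    ; <-trans   = λ p q → <-≤-trans _ _ _ p (<⇒≤ _ _ q)
    ; compare   = compare
    ; ≮0        = ≮𝟘
    ; <1⇒≈0     = <𝟙⇒≈𝟘
    ; +-option  = λ p → proj₂ (⊕-isMex _ _) _ p
    ; *-option  = λ p → proj₂ (⊗-isMex _ _) _ p
    }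

  open NimOrder nimOrder 𝟙≉𝟘

  ⟦⟧-cong : ∀ {as bs} → Pointwise _≈_ as bs → ∀ α → ⟦ as ⟧ α ≈ ⟦ bs ⟧ α
  ⟦⟧-cong []       α = ≈-refl 𝟘
  ⟦⟧-cong (e ∷ es) α = ⊕-cong e (⊗-congˡ (⟦⟧-cong es α))

  hasNonZero-resp : ∀ {as bs} → Pointwise _≈_ as bs → HasNonZero as → HasNonZero bs
  hasNonZero-resp (e ∷ es) (here a≉0) = here (a≉0 ∘ ≈-trans e)
  hasNonZero-resp (e ∷ es) (there nz) = there (hasNonZero-resp es nz)

  -- Once a root r is chosen, every other root is a root of the quotient by X - r. The quotient is
  -- shorter but not a sublist, hence the recursion on the length.
  roots-bounded : ∀ n as → length as ≡ n → HasNonZero as →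
                  ∃[ β ] (∀ α → ⟦ as ⟧ α ≈ 𝟘 → α < β)
  roots-bounded (ℕ.suc n) (a ∷ as) l nz with em⁺ {∃[ r ] ⟦ a ∷ as ⟧ r ≈ 𝟘}
  ... | no  rootless = 𝟘 , λ α e → contradiction (α , e) rootless
  ... | yes (r , e) with hasNonZero? as
  ...   | no ¬nz  = contradiction (≈-trans (≈-sym (⟦⟧-constant as ¬nz r)) e) (head-nonZero nz ¬nz)
  ...   | yes nz′ =
    let β , β-bound = roots-bounded n (quotient r as)
                        (≡.trans (length-quotient r as) (ℕ.suc-injective l))
                        (quotient-nonZero r nz′)
    in sup (Lift ℓ Bool) (λ (lift b) → if b then r else β) , λ α e′ →
      case root-or-quotient-root r as e e′ of λ where
        (inj₁ (α≤r , _)) → lift true  , α≤r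
        (inj₂ e″)        → lift false , <⇒≤ α β (β-bound α e″)

  -- A bound for every list, so that `sup` can range over all of them; zero polynomials get the
  -- default 𝟘.
  root-bound : ∀ as → ∃[ β ] (HasNonZero as → ∀ α → ⟦ as ⟧ α ≈ 𝟘 → α < β)
  root-bound as = bound (hasNonZero? as)
    where
    bound : Dec (HasNonZero as) → ∃[ β ] (HasNonZero as → ∀ α → ⟦ as ⟧ α ≈ 𝟘 → α < β)
    bound (yes nz) = let β , p = roots-bounded _ as ≡.refl nz in β , λ _ → p
    bound (no ¬nz) = 𝟘 , λ nz → contradiction nz ¬nz

  integral-bounded : IsSubfield (_< u) → ∃[ β ] (∀ α → Integral (_< u) α → α < β)
  integral-bounded {u} F = bound , λ α Kα →
    let f , nz , e = integral⇒root isSubring 𝟙≉𝟘 Kα in root<bound f nz α e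
    where
    open IsSubfield F

    -- Lists over `∃ (_< u)` are one universe too large to index a `sup`; lists over `Below u` are
    -- small and represent them up to `_≈_`.
    bound : Ord ℓ
    bound = sup (List (Below u)) λ p → proj₁ (root-bound (map (el u) p))

    represent : (f : List (∃ (_< u))) → ∃[ p ] Pointwise _≈_ (map proj₁ f) (map (el u) p)
    represent []              = [] , []
    represent ((a , a<u) ∷ f) =
      let b , e  = el-surjective u a<u
          p , es = represent f
      in b ∷ p , e ∷ es

    root<bound : (f : List (∃ (_< u))) → NonZero f → ∀ α → eval f α ≈ 𝟘 → α < bound
    root<bound f nz α e =
      let p , f≈p = represent f
          as      = map (el u) p
      in p , <⇒≤ α (proj₁ (root-bound as))
               (proj₂ (root-bound as) (hasNonZero-resp f≈p (Any.map⁺ nz)) α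
                 (≈-trans (≈-sym (⟦⟧-cong f≈p α)) e))

  least-counterexample : {P : Ord ℓ → Set (Level.suc ℓ)} → ∀ β → ¬ P β →
                         ∃[ t ] ¬ P t × (∀ α → α < t → P α)
  least-counterexample {P} β = go β (<-wellFounded β)
    where
    go : ∀ β → Acc _<_ β → ¬ P β → ∃[ t ] ¬ P t × (∀ α → α < t → P α)
    go β (acc r) ¬Pβ with em⁺ {∃[ α ] α < β × ¬ P α}
    ... | yes (α , α<β , ¬Pα) = go α (r α<β) ¬Pα
    ... | no  none = β , ¬Pβ , λ α α<β → decidable-stable em⁺ λ ¬Pα → none (α , α<β , ¬Pα)

  module LeastTranscendental (K : IsSubfield (_< u)) (¬Kt : ¬ Integral (_< u) t)
                             (below⇒integral : ∀ α → α < t → Integral (_< u) α) where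

    open IsSubfield K using () renaming (isSubring to K-subring)

    u≤t : u ≤ t
    u≤t = decidable-stable em λ u≰t → ¬Kt (const-integral K (≰⇒> u t u≰t))

    <u⇒<t : α < u → α < t
    <u⇒<t p = <-≤-trans _ u t p u≤t

    -- An integral ordinal is not t, so closure only has to refute t < α. In that case t is itself
    -- an option, which induction places below t.
    integral-≯⇒< : Integral (_< u) α → ¬ t < α → α < t
    integral-≯⇒< {α} Kα t≮α = case compare α t of λ where
      (inj₁ α<t)        → α<t
      (inj₂ (inj₁ α≈t)) → contradiction (integral-resp K α≈t Kα) ¬Kt
      (inj₂ (inj₂ t<α)) → contradiction t<α t≮α

    ⊕-closed : α < t → β < t → α ⊕ β < t
    ⊕-closed {α} {β} = go α β (<-wellFounded α) (<-wellFounded β)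
      where
      go : ∀ α β → Acc _<_ α → Acc _<_ β → α < t → β < t → α ⊕ β < t
      go α β (acc r) (acc s) α<t β<t = integral-≯⇒<
        (integral-+ K (below⇒integral α α<t) (below⇒integral β β<t))
        λ t<α⊕β → case proj₂ (⊕-isMex α β) t t<α⊕β of λ where
          (inj₁ (α′ , p , e)) → <⇒≉
            (go α′ β (r p) (acc s) (<-≤-trans α′ α t p (<⇒≤ α t α<t)) β<t) (≈-sym e)
          (inj₂ (β′ , p , e)) → <⇒≉
            (go α β′ (acc r) (s p) α<t (<-≤-trans β′ β t p (<⇒≤ β t β<t))) (≈-sym e)

    ⊗-closed : α < t → β < t → α ⊗ β < t
    ⊗-closed {α} {β} = go α β (<-wellFounded α) (<-wellFounded β)
      where
      go : ∀ α β → Acc _<_ α → Acc _<_ β → α < t → β < t → α ⊗ β < t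
      go α β (acc r) (acc s) α<t β<t = integral-≯⇒<
        (integral-* K (below⇒integral α α<t) (below⇒integral β β<t))
        λ t<α⊗β →
          let α′ , β′ , p , q , e = proj₂ (⊗-isMex α β) t t<α⊗β
              α′<t = <-≤-trans α′ α t p (<⇒≤ α t α<t)
              β′<t = <-≤-trans β′ β t q (<⇒≤ β t β<t)
          in <⇒≉ (⊕-closed (⊕-closed (go α′ β (r p) (acc s) α′<t β<t)
                                     (go α β′ (acc r) (s q) α<t β′<t))
                           (go α′ β′ (r p) (s q) α′<t β′<t))
                 (≈-sym e)

    t-subring : IsSubring (_< t)
    t-subring = record
      { resp     = λ e p → <-respˡ-≈ p e
      ; 1∈       = <u⇒<t (IsSubring.1∈ K-subring)
      ; +-closed = ⊕-closed
      ; *-closed = ⊗-closed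
      }

    t-subfield : IsSubfield (_< t)
    t-subfield = record
      { isSubring = t-subring
      ; inverse   = λ p → integral-inverse K t-subring <u⇒<t p (below⇒integral _ p)
      }

    t-transcendental : ¬ Integral (_< t) t
    t-transcendental = ¬Kt ∘ integral-trans K (below⇒integral _)

    open TranscendentalSegment t-subfield t-transcendental

    -- An equation over u is one over t, where it splits into factors with roots below t.
    integral⇒below : Integral (_< u) α → α < t
    integral⇒below Kα =
      let f , nz , e = integral⇒root t-subring 𝟙≉𝟘 (integral-mono <u⇒<t Kα) in root<t f nz e

  least-transcendental-isClosure : (F : IsFieldOrdinal u) →
    ¬ Integral (_< u) t → (∀ α → α < t → Integral (_< u) α) →
    (∀ α → (α < t) ⇔ IsFieldOrdinal.Algebraic F α) ×
    Σ (IsFieldOrdinal t) λ G → Σ (u ≤ t) λ u≤t →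
    IsAlgebraicClosure (IsFieldOrdinal.restriction F) (IsFieldOrdinal.restriction G) (inclusion u≤t)
  least-transcendental-isClosure {u} {t} F ¬Kt below⇒integral =
    (λ α → mk⇔ algebraic (λ (f , nz , e) → integral⇒below (root⇒integral K f nz e))) ,
    G , u≤t , record
      { isField-base          = IsFieldOrdinal.isField F
      ; isField               = IsFieldOrdinal.isField G
      ; isRingHomomorphism    = record
        { isSemiringHomomorphism = record
          { isNearSemiringHomomorphism = record
            { +-isMonoidHomomorphism = record
              { isMagmaHomomorphism = record
                { isRelHomomorphism = record { cong = id }
                ; homo = λ _ _ → ≈-refl _ }
              ; ε-homo = ≈-refl _ }
            ; *-homo = λ _ _ → ≈-refl _ }
          ; 1#-homo = ≈-refl _ }
        ; -‿homo = λ _ → ≈-refl _ }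
      ; algebraic             = λ x@(α , α<t) →
          let f , nz , e = algebraic α<t
          in f , nz , ≡.subst (_≈ 𝟘) (≡.sym (eval-inclusion f x)) e
      ; isAlgebraicallyClosed = λ where
          ((a , a<t) ∷ f) nz →
            let r , r<t , e = root a a<t f nz
            in (r , r<t) , ≡.subst (_≈ 𝟘) (≡.sym (eval-restriction ((a , a<t) ∷ f) (r , r<t))) e
      }
    where
    K = fieldOrdinal⇒subfield F
    open LeastTranscendental K ¬Kt below⇒integral
    open TranscendentalSegment t-subfield t-transcendental

    G : IsFieldOrdinal t
    G = subfield⇒fieldOrdinal t-subfield

    module G[X] = Polynomial (IsFieldOrdinal.restriction G)

    algebraic : α < t → IsFieldOrdinal.Algebraic F α
    algebraic α<t = integral⇒root (IsSubfield.isSubring K) 𝟙≉𝟘 (below⇒integral _ α<t)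

    eval-inclusion : ∀ f x → proj₁ (G[X].⟦ map (inclusion u≤t) f ⟧ x) ≡ eval f (proj₁ x)
    eval-inclusion []      x = ≡.refl
    eval-inclusion (a ∷ f) x = ≡.cong (λ y → proj₁ a ⊕ proj₁ x ⊗ y) (eval-inclusion f x)

    eval-restriction : ∀ f x → proj₁ (G[X].⟦ f ⟧ x) ≡ eval f (proj₁ x)
    eval-restriction []      x = ≡.refl
    eval-restriction (a ∷ f) x = ≡.cong (λ y → proj₁ a ⊕ proj₁ x ⊗ y) (eval-restriction f x)

open import Level using (suc)

proposition3p1 : ∀ {ℓ} → ExcludedMiddle (suc ℓ) →
    (u : Ord ℓ) (F : IsFieldOrdinal u) →
    ∃[ v ] ((∀ α → (α < v) ⇔ IsFieldOrdinal.Algebraic F α) ×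
    Σ (IsFieldOrdinal v) λ G → Σ (u ≤ v) λ u≤v →
    IsAlgebraicClosure (IsFieldOrdinal.restriction F) (IsFieldOrdinal.restriction G) (inclusion u≤v))
proposition3p1 em u F =
  let β , bounded     = integral-bounded (fieldOrdinal⇒subfield F)
      -- The bound β is strict, so β itself is not integral and the descent can start there.
      t , ¬Kt , below = least-counterexample β (<-irrefl β ∘ bounded β)
  in t , least-transcendental-isClosure F ¬Kt below
  where open FieldOrdinals em
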